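{- For all integers $n,k\geq 2$, $$f(n,k)\geq \min_{t\geq n(k-1)+1}\max\left\{f(n-1,k)+t,\ \frac{t^{1/(k-1)}}{t^{1/(k-1)}-1}\bigl(f(n-2,k)+1\bigr)-1\right\},$$ where the minimum is taken over integers $t\geq n(k-1)+1$.
   Context: All graphs are finite, simple and undirected. For integers $n\geq 0$ and $k\geq 2$, $f(n,k)$ denotes the maximal integer $f$ with the following property: if a graph $G=(V,E)$ contains no odd cycles of length at most $2k-1$ and $|V|\leq f$, then $G$ has a proper vertex coloring in $n$ colors. In particular $f(0,k)=0$ and $f(1,k)=1$. -}

module Defs where

open import Data.Nat as ℕ using (ℕ; zero; suc; z≤n; s≤s)
import Data.Nat.Properties as ℕ
open import Data.Nat.Divisibility using (_∣_)
open import Data.Nat.Solver using (module +-*-Solver)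
open import Data.Integer as ℤ using (ℤ; +_; -[1+_])
import Data.Integer.Properties as ℤ
open import Data.Fin using (Fin; zero; suc; inject₁; fromℕ)
open import Data.Product using (Σ; ∃; ∃-syntax; _×_; _,_; proj₁; proj₂)
open import Data.Sum using (inj₁; inj₂)
open import Data.Rational as ℚ using (ℚ; 0ℚ; 1ℚ; ½; _+_; _*_; _-_; -_; ∣_∣; _⊔_; _≤_; _<_; _/_)
import Data.Rational.Properties as ℚ
import Data.Rational.Solver as ℚSolver
import Data.Rational.Unnormalised as ℚᵘ
import Data.Rational.Unnormalised.Properties as ℚᵘ
open import Function.Definitions using (Injective)
open import Level using (0ℓ)
open import Relation.Binary.Core using (Rel)
open import Relation.Binary.Definitions using (Symmetric; Irreflexive; Decidable)
open import Relation.Binary.PropositionalEquality hiding (J)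
open import Relation.Nullary using (¬_; yes; no; contradiction)

record Graph (m : ℕ) : Set₁ where
  field
    _~_      : Rel (Fin m) 0ℓ
    ~-sym    : Symmetric _~_
    ~-irrefl : Irreflexive _≡_ _~_
    _~?_     : Decidable _~_

-- The length of the cycle is suc ℓ.
record Cycle {m : ℕ} (G : Graph m) (ℓ : ℕ) : Set where
  open Graph G
  field
    vertex   : Fin (suc ℓ) → Fin m
    distinct : Injective _≡_ _≡_ vertex
    step     : ∀ (i : Fin ℓ) → vertex (inject₁ i) ~ vertex (suc i)
    close    : vertex (fromℕ ℓ) ~ vertex zero
    length≥3 : 3 ℕ.≤ suc ℓ

NoOddCycle≤ : ∀ {m} → ℕ → Graph m → Set
NoOddCycle≤ L G = ∀ ℓ → suc ℓ ℕ.≤ L → ¬ (2 ∣ suc ℓ) → ¬ Cycle G ℓ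

Colorable : ∀ {m} → ℕ → Graph m → Set
Colorable {m} n G = Σ (Fin m → Fin n) λ color → ∀ u v → u ~ v → color u ≢ color v
  where open Graph G

ForcesColorable : (n k f : ℕ) → Set₁
ForcesColorable n k f = ∀ {m} (G : Graph m) →
  NoOddCycle≤ (2 ℕ.* k ℕ.∸ 1) G → m ℕ.≤ f → Colorable n G

-- f(n,k) is treated as a relation, since its existence for all n and k is
-- itself a theorem.  Negative integers are irrelevant to the maximum, because
-- 0 always has the property.
f[_,_]≡_ : (n k f : ℕ) → Set₁
f[ n , k ]≡ f = ForcesColorable n k f × (∀ g → ForcesColorable n k g → g ℕ.≤ f)

Cauchy : (ℕ → ℚ) → Set
Cauchy x = ∀ ε → 0ℚ < ε →
  ∃[ N ] (∀ i j → N ℕ.≤ i → N ℕ.≤ j → ∣ x i - x j ∣ ≤ ε)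

record ℝ : Set where
  constructor mkℝ
  field
    seq    : ℕ → ℚ
    cauchy : Cauchy seq

open ℝ public

infix 4 _≤ᴿ_ _<ᴿ_ _≃ᴿ_

_≤ᴿ_ : Rel ℝ 0ℓ
x ≤ᴿ y = ∀ ε → 0ℚ < ε → ∃[ N ] (∀ i → N ℕ.≤ i → seq x i ≤ seq y i + ε)

_<ᴿ_ : Rel ℝ 0ℓ
x <ᴿ y = ∃[ ε ] (0ℚ < ε × ∃[ N ] (∀ i → N ℕ.≤ i → seq x i + ε ≤ seq y i))

_≃ᴿ_ : Rel ℝ 0ℓ
x ≃ᴿ y = x ≤ᴿ y × y ≤ᴿ x

private open module ℚS = ℚSolver.+-*-Solver using (solve; _:=_; con) renaming (_:+_ to _⊕_; _:*_ to _⊗_; :-_ to ⊝_)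

ε/2>0 : ∀ {ε} → 0ℚ < ε → 0ℚ < ε * ½
ε/2>0 {ε} ε>0 = subst (_< ε * ½) (ℚ.*-zeroˡ ½) (ℚ.*-monoˡ-<-pos ½ ε>0)

ε/2+ε/2 : ∀ ε → ε * ½ + ε * ½ ≡ ε
ε/2+ε/2 ε = trans (sym (ℚ.*-distribˡ-+ ε ½ ½)) (ℚ.*-identityʳ ε)

*>0 : ∀ {p q} → 0ℚ < p → 0ℚ < q → 0ℚ < p * q
*>0 {p} {q} p>0 q>0 = subst (_< p * q) (ℚ.*-zeroˡ q)
  (ℚ.*-monoˡ-<-pos q {{ℚ.positive q>0}} p>0)

*-mono-≤ : ∀ {p p′ q q′} → 0ℚ ≤ q → 0ℚ ≤ p′ → p ≤ p′ → q ≤ q′ → p * q ≤ p′ * q′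
*-mono-≤ {p} {p′} {q} {q′} q≥0 p′≥0 p≤p′ q≤q′ = ℚ.≤-trans
  (ℚ.*-monoʳ-≤-nonNeg q {{ℚ.nonNegative q≥0}} p≤p′)
  (ℚ.*-monoˡ-≤-nonNeg p′ {{ℚ.nonNegative p′≥0}} q≤q′)

p≤∣p∣ : ∀ p → p ≤ ∣ p ∣
p≤∣p∣ p with ℚ.≤-total 0ℚ p
... | inj₁ 0≤p = ℚ.≤-reflexive (sym (ℚ.0≤p⇒∣p∣≡p 0≤p))
... | inj₂ p≤0 = ℚ.≤-trans p≤0 (ℚ.0≤∣p∣ p)

∣p-q∣≡∣q-p∣ : ∀ p q → ∣ p - q ∣ ≡ ∣ q - p ∣
∣p-q∣≡∣q-p∣ p q = trans
  (cong ∣_∣ (solve 2 (λ p q → p ⊕ ⊝ q := ⊝ (q ⊕ ⊝ p)) refl p q)) (ℚ.∣-p∣≡∣p∣ (q - p))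

∣p-q∣≤ε⇒p≤q+ε : ∀ {p q ε} → ∣ p - q ∣ ≤ ε → p ≤ q + ε
∣p-q∣≤ε⇒p≤q+ε {p} {q} h = subst (_≤ _)
  (solve 2 (λ p q → q ⊕ (p ⊕ ⊝ q) := p) refl p q)
  (ℚ.+-monoʳ-≤ q (ℚ.≤-trans (p≤∣p∣ (p - q)) h))

p≤q+ε⇒p-q≤ε : ∀ {p q ε} → p ≤ q + ε → p - q ≤ ε
p≤q+ε⇒p-q≤ε {p} {q} {ε} h = subst (p - q ≤_)
  (solve 2 (λ q ε → (q ⊕ ε) ⊕ ⊝ q := ε) refl q ε) (ℚ.+-monoˡ-≤ (- q) h)

∣p-q∣≤ε : ∀ {p q ε} → p ≤ q + ε → q ≤ p + ε → ∣ p - q ∣ ≤ ε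
∣p-q∣≤ε {p} {q} {ε} h h′ with ℚ.∣p∣≡p∨∣p∣≡-p (p - q)
... | inj₁ eq = subst (_≤ ε) (sym eq) (p≤q+ε⇒p-q≤ε h)
... | inj₂ eq = subst (_≤ ε)
  (sym (trans eq (solve 2 (λ p q → ⊝ (p ⊕ ⊝ q) := q ⊕ ⊝ p) refl p q))) (p≤q+ε⇒p-q≤ε h′)

-- The junk value at 0 keeps the sequence of a reciprocal independent of
-- the proof that its argument is positive.
inv : ℚ → ℚ
inv q with q ℚ.≟ 0ℚ
... | yes _   = 0ℚ
... | no  q≢0 = ℚ.1/_ q {{ℚ.≢-nonZero q≢0}}

inv-inverseˡ : ∀ {q} → 0ℚ < q → inv q * q ≡ 1ℚ
inv-inverseˡ {q} q>0 with q ℚ.≟ 0ℚ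
... | yes q≡0 = contradiction (sym q≡0) (ℚ.<⇒≢ q>0)
... | no  q≢0 = ℚ.*-inverseˡ q {{ℚ.≢-nonZero q≢0}}

inv-pos : ∀ {q} → 0ℚ < q → 0ℚ < inv q
inv-pos {q} q>0 with q ℚ.≟ 0ℚ
... | yes q≡0 = contradiction (sym q≡0) (ℚ.<⇒≢ q>0)
... | no  q≢0 = ℚ.positive⁻¹ _ {{ℚ.1/pos⇒pos q {{ℚ.positive q>0}}}}

inv-antimono : ∀ {p q} → 0ℚ < p → p ≤ q → inv q ≤ inv p
inv-antimono {p} {q} p>0 p≤q = begin
  inv q                 ≡⟨ ℚ.*-identityʳ (inv q) ⟨
  inv q * 1ℚ            ≡⟨ cong (inv q *_) (inv-inverseˡ p>0) ⟨
  inv q * (inv p * p)   ≤⟨ ℚ.*-monoˡ-≤-nonNeg (inv q) {{nn q>0}} (ℚ.*-monoˡ-≤-nonNeg (inv p) {{nn p>0}} p≤q) ⟩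
  inv q * (inv p * q)   ≡⟨ solve 3 (λ a b q → a ⊗ (b ⊗ q) := (a ⊗ q) ⊗ b) refl (inv q) (inv p) q ⟩
  (inv q * q) * inv p   ≡⟨ cong (_* inv p) (inv-inverseˡ q>0) ⟩
  1ℚ * inv p            ≡⟨ ℚ.*-identityˡ (inv p) ⟩
  inv p                 ∎
  where
  open ℚ.≤-Reasoning
  q>0 = ℚ.<-≤-trans p>0 p≤q
  nn : ∀ {r} → 0ℚ < r → ℚ.NonNegative (inv r)
  nn r>0 = ℚ.nonNegative (ℚ.<⇒≤ (inv-pos r>0))

bounded : ∀ x → ∃[ B ] (0ℚ < B × ∃[ N ] (∀ i → N ℕ.≤ i → ∣ seq x i ∣ ≤ B))
bounded x with cauchy x 1ℚ (ℚ.positive⁻¹ 1ℚ)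
... | N , h = ∣ seq x N ∣ + 1ℚ
  , ℚ.+-mono-≤-< (ℚ.0≤∣p∣ (seq x N)) (ℚ.positive⁻¹ 1ℚ) , N , λ i i≥N → begin
    ∣ seq x i ∣                            ≡⟨ cong ∣_∣ (solve 2 (λ a b → a := b ⊕ (a ⊕ ⊝ b)) refl (seq x i) (seq x N)) ⟩
    ∣ seq x N + (seq x i - seq x N) ∣      ≤⟨ ℚ.∣p+q∣≤∣p∣+∣q∣ (seq x N) _ ⟩
    ∣ seq x N ∣ + ∣ seq x i - seq x N ∣    ≤⟨ ℚ.+-monoʳ-≤ ∣ seq x N ∣ (h i N i≥N ℕ.≤-refl) ⟩
    ∣ seq x N ∣ + 1ℚ                       ∎
  where open ℚ.≤-Reasoning

fromℚᴿ : ℚ → ℝ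
fromℚᴿ q = mkℝ (λ _ → q) λ ε ε>0 →
  0 , λ _ _ _ _ → subst (_≤ ε) (sym (cong ∣_∣ (ℚ.+-inverseʳ q))) (ℚ.<⇒≤ ε>0)

fromℕᴿ : ℕ → ℝ
fromℕᴿ n = fromℚᴿ (+ n / 1)

0ᴿ 1ᴿ : ℝ
0ᴿ = fromℕᴿ 0
1ᴿ = fromℕᴿ 1

infixl 6 _+ᴿ_ _-ᴿ_ _⊔ᴿ_
infixl 7 _*ᴿ_ _÷ᴿ_⟨_⟩
infix  8 -ᴿ_

_+ᴿ_ : ℝ → ℝ → ℝ
x +ᴿ y = mkℝ (λ i → seq x i + seq y i) λ ε ε>0 →
  let N , h = cauchy x (ε * ½) (ε/2>0 ε>0) ; M , g = cauchy y (ε * ½) (ε/2>0 ε>0)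
  in N ℕ.⊔ M , λ i j i≥ j≥ → begin
    ∣ (seq x i + seq y i) - (seq x j + seq y j) ∣
      ≡⟨ cong ∣_∣ (solve 4 (λ a b c d → (a ⊕ b) ⊕ ⊝ (c ⊕ d) := (a ⊕ ⊝ c) ⊕ (b ⊕ ⊝ d)) refl
           (seq x i) (seq y i) (seq x j) (seq y j)) ⟩
    ∣ (seq x i - seq x j) + (seq y i - seq y j) ∣
      ≤⟨ ℚ.∣p+q∣≤∣p∣+∣q∣ (seq x i - seq x j) _ ⟩
    ∣ seq x i - seq x j ∣ + ∣ seq y i - seq y j ∣
      ≤⟨ ℚ.+-mono-≤ (h i j (ℕ.m⊔n≤o⇒m≤o N M i≥) (ℕ.m⊔n≤o⇒m≤o N M j≥))
                    (g i j (ℕ.m⊔n≤o⇒n≤o N M i≥) (ℕ.m⊔n≤o⇒n≤o N M j≥)) ⟩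
    ε * ½ + ε * ½  ≡⟨ ε/2+ε/2 ε ⟩
    ε              ∎
  where open ℚ.≤-Reasoning

-ᴿ_ : ℝ → ℝ
-ᴿ x = mkℝ (λ i → - seq x i) λ ε ε>0 →
  let N , h = cauchy x ε ε>0
  in N , λ i j i≥ j≥ → subst (_≤ ε)
       (cong ∣_∣ (solve 2 (λ a b → b ⊕ ⊝ a := ⊝ a ⊕ ⊝ (⊝ b)) refl (seq x i) (seq x j)))
       (h j i j≥ i≥)

_-ᴿ_ : ℝ → ℝ → ℝ
x -ᴿ y = x +ᴿ (-ᴿ y)

⊔-mono-+ε : ∀ {p q p′ q′ ε} → p ≤ p′ + ε → q ≤ q′ + ε → p ⊔ q ≤ (p′ ⊔ q′) + ε
⊔-mono-+ε {p} {q} {p′} {q′} {ε} h g = ℚ.⊔-lub {y = p} {z = q}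
  (ℚ.≤-trans h (ℚ.+-monoˡ-≤ ε (ℚ.p≤p⊔q p′ q′)))
  (ℚ.≤-trans g (ℚ.+-monoˡ-≤ ε (ℚ.p≤q⊔p p′ q′)))

_⊔ᴿ_ : ℝ → ℝ → ℝ
x ⊔ᴿ y = mkℝ (λ i → seq x i ⊔ seq y i) λ ε ε>0 →
  let N , h = cauchy x ε ε>0 ; M , g = cauchy y ε ε>0
      bound : ∀ i j → N ℕ.⊔ M ℕ.≤ i → N ℕ.⊔ M ℕ.≤ j → seq x i ⊔ seq y i ≤ (seq x j ⊔ seq y j) + ε
      bound = λ i j i≥ j≥ → ⊔-mono-+ε {seq x i} {seq y i} {seq x j} {seq y j}
        (∣p-q∣≤ε⇒p≤q+ε (h i j (ℕ.m⊔n≤o⇒m≤o N M i≥) (ℕ.m⊔n≤o⇒m≤o N M j≥)))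
        (∣p-q∣≤ε⇒p≤q+ε (g i j (ℕ.m⊔n≤o⇒n≤o N M i≥) (ℕ.m⊔n≤o⇒n≤o N M j≥)))
  in N ℕ.⊔ M , λ i j i≥ j≥ → ∣p-q∣≤ε (bound i j i≥ j≥) (bound j i j≥ i≥)

_*ᴿ_ : ℝ → ℝ → ℝ
x *ᴿ y = mkℝ (λ i → seq x i * seq y i) λ ε ε>0 →
  let B , B>0 , N₁ , b = bounded x
      C , C>0 , N₂ , c = bounded y
      S>0  = ℚ.+-mono-< B>0 C>0
      δ    = ε * inv (B + C)
      δ>0  = *>0 ε>0 (inv-pos S>0)
      N₃ , h = cauchy x δ δ>0
      N₄ , g = cauchy y δ δ>0
      N    = (N₁ ℕ.⊔ N₂) ℕ.⊔ (N₃ ℕ.⊔ N₄)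
      ≥N₁  = λ {i} (p : N ℕ.≤ i) → ℕ.m⊔n≤o⇒m≤o N₁ N₂ (ℕ.m⊔n≤o⇒m≤o (N₁ ℕ.⊔ N₂) (N₃ ℕ.⊔ N₄) p)
      ≥N₂  = λ {i} (p : N ℕ.≤ i) → ℕ.m⊔n≤o⇒n≤o N₁ N₂ (ℕ.m⊔n≤o⇒m≤o (N₁ ℕ.⊔ N₂) (N₃ ℕ.⊔ N₄) p)
      ≥N₃  = λ {i} (p : N ℕ.≤ i) → ℕ.m⊔n≤o⇒m≤o N₃ N₄ (ℕ.m⊔n≤o⇒n≤o (N₁ ℕ.⊔ N₂) (N₃ ℕ.⊔ N₄) p)
      ≥N₄  = λ {i} (p : N ℕ.≤ i) → ℕ.m⊔n≤o⇒n≤o N₃ N₄ (ℕ.m⊔n≤o⇒n≤o (N₁ ℕ.⊔ N₂) (N₃ ℕ.⊔ N₄) p)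
  in N , λ i j i≥ j≥ → begin
    ∣ seq x i * seq y i - seq x j * seq y j ∣
      ≡⟨ cong ∣_∣ (solve 4 (λ a b c d → a ⊗ b ⊕ ⊝ (c ⊗ d) := a ⊗ (b ⊕ ⊝ d) ⊕ (a ⊕ ⊝ c) ⊗ d) refl
           (seq x i) (seq y i) (seq x j) (seq y j)) ⟩
    ∣ seq x i * (seq y i - seq y j) + (seq x i - seq x j) * seq y j ∣
      ≤⟨ ℚ.∣p+q∣≤∣p∣+∣q∣ (seq x i * (seq y i - seq y j)) _ ⟩
    ∣ seq x i * (seq y i - seq y j) ∣ + ∣ (seq x i - seq x j) * seq y j ∣
      ≡⟨ cong₂ _+_ (ℚ.∣p*q∣≡∣p∣*∣q∣ (seq x i) _) (ℚ.∣p*q∣≡∣p∣*∣q∣ (seq x i - seq x j) _) ⟩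
    ∣ seq x i ∣ * ∣ seq y i - seq y j ∣ + ∣ seq x i - seq x j ∣ * ∣ seq y j ∣
      ≤⟨ ℚ.+-mono-≤
           (*-mono-≤ (ℚ.0≤∣p∣ (seq y i - seq y j)) (ℚ.<⇒≤ B>0) (b i (≥N₁ i≥)) (g i j (≥N₄ i≥) (≥N₄ j≥)))
           (*-mono-≤ (ℚ.0≤∣p∣ (seq y j)) (ℚ.<⇒≤ δ>0) (h i j (≥N₃ i≥) (≥N₃ j≥)) (c j (≥N₂ j≥))) ⟩
    B * δ + δ * C
      ≡⟨ solve 4 (λ b c e v → b ⊗ (e ⊗ v) ⊕ (e ⊗ v) ⊗ c := e ⊗ (v ⊗ (b ⊕ c))) refl B C ε (inv (B + C)) ⟩
    ε * (inv (B + C) * (B + C))  ≡⟨ cong (ε *_) (inv-inverseˡ S>0) ⟩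
    ε * 1ℚ                       ≡⟨ ℚ.*-identityʳ ε ⟩
    ε                            ∎
  where open ℚ.≤-Reasoning

invᴿ : (x : ℝ) → 0ᴿ <ᴿ x → ℝ
invᴿ x (δ , δ>0 , N , x≥0+δ) = mkℝ (λ i → inv (seq x i)) λ ε ε>0 →
  let M , h = cauchy x (ε * (δ * δ)) (*>0 ε>0 (*>0 δ>0 δ>0))
      D = inv δ
      x≥δ  = λ i (i≥ : N ℕ.⊔ M ℕ.≤ i) →
        subst (_≤ seq x i) (ℚ.+-identityˡ δ) (x≥0+δ i (ℕ.m⊔n≤o⇒m≤o N M i≥))
      x>0  = λ i i≥ → ℚ.<-≤-trans δ>0 (x≥δ i i≥)
      ∣I∣≤D = λ i i≥ → subst (_≤ D) (sym (ℚ.0≤p⇒∣p∣≡p (ℚ.<⇒≤ (inv-pos (x>0 i i≥)))))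
                        (inv-antimono δ>0 (x≥δ i i≥))
      D≥0  = ℚ.<⇒≤ (inv-pos δ>0)
  in N ℕ.⊔ M , λ i j i≥ j≥ →
    let a = seq x i ; b = seq x j ; A = inv a ; B = inv b in begin
    ∣ A - B ∣
      ≡⟨ cong ∣_∣ (cong₂ _-_ (sym (ℚ.*-identityʳ A)) (sym (ℚ.*-identityʳ B))) ⟩
    ∣ A * 1ℚ - B * 1ℚ ∣
      ≡⟨ cong ∣_∣ (cong₂ (λ s t → A * s - B * t) (inv-inverseˡ (x>0 j j≥)) (inv-inverseˡ (x>0 i i≥))) ⟨
    ∣ A * (B * b) - B * (A * a) ∣
      ≡⟨ cong ∣_∣ (solve 4 (λ A B a b → A ⊗ (B ⊗ b) ⊕ ⊝ (B ⊗ (A ⊗ a)) := (b ⊕ ⊝ a) ⊗ (A ⊗ B)) refl A B a b) ⟩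
    ∣ (b - a) * (A * B) ∣        ≡⟨ ℚ.∣p*q∣≡∣p∣*∣q∣ (b - a) (A * B) ⟩
    ∣ b - a ∣ * ∣ A * B ∣        ≡⟨ cong (∣ b - a ∣ *_) (ℚ.∣p*q∣≡∣p∣*∣q∣ A B) ⟩
    ∣ b - a ∣ * (∣ A ∣ * ∣ B ∣)
      ≤⟨ *-mono-≤ (subst (0ℚ ≤_) (ℚ.∣p*q∣≡∣p∣*∣q∣ A B) (ℚ.0≤∣p∣ (A * B)))
                  (ℚ.<⇒≤ (*>0 ε>0 (*>0 δ>0 δ>0)))
                  (h j i (ℕ.m⊔n≤o⇒n≤o N M j≥) (ℕ.m⊔n≤o⇒n≤o N M i≥))
                  (*-mono-≤ (ℚ.0≤∣p∣ B) D≥0 (∣I∣≤D i i≥) (∣I∣≤D j j≥)) ⟩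
    ε * (δ * δ) * (D * D)
      ≡⟨ solve 3 (λ e d v → e ⊗ (d ⊗ d) ⊗ (v ⊗ v) := e ⊗ ((v ⊗ d) ⊗ (v ⊗ d))) refl ε δ D ⟩
    ε * ((D * δ) * (D * δ))      ≡⟨ cong (ε *_) (cong₂ _*_ (inv-inverseˡ δ>0) (inv-inverseˡ δ>0)) ⟩
    ε * 1ℚ                       ≡⟨ ℚ.*-identityʳ ε ⟩
    ε                            ∎
  where open ℚ.≤-Reasoning

_÷ᴿ_⟨_⟩ : (x y : ℝ) → 0ᴿ <ᴿ y → ℝ
x ÷ᴿ y ⟨ y>0 ⟩ = x *ᴿ invᴿ y y>0

search : (m x b : ℕ) → ℕ
search m x zero    = 0
search m x (suc b) with suc b ℕ.^ m ℕ.≤? x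
... | yes _ = suc b
... | no  _ = search m x b

-- ⌊ x^(1/m) ⌋ for m ≥ 1: the largest a ≤ x with a ^ m ≤ x.
iroot : (m x : ℕ) → ℕ
iroot m x = search m x x

search-lower : ∀ p x b → search (suc p) x b ℕ.^ suc p ℕ.≤ x
search-lower p x zero    = z≤n
search-lower p x (suc b) with suc b ℕ.^ suc p ℕ.≤? x
... | yes h = h
... | no  _ = search-lower p x b

search-upper : ∀ p x b → x ℕ.< suc b ℕ.^ suc p → x ℕ.< suc (search (suc p) x b) ℕ.^ suc p
search-upper p x zero    h = h
search-upper p x (suc b) h with suc b ℕ.^ suc p ℕ.≤? x
... | yes _ = h
... | no ¬h = search-upper p x b (ℕ.≰⇒> ¬h)

1≤[1+n]^p : ∀ n p → 1 ℕ.≤ suc n ℕ.^ p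
1≤[1+n]^p n p = ℕ.m^n>0 (suc n) p

iroot-lower : ∀ p x → iroot (suc p) x ℕ.^ suc p ℕ.≤ x
iroot-lower p x = search-lower p x x

iroot-upper : ∀ p x → x ℕ.< suc (iroot (suc p) x) ℕ.^ suc p
iroot-upper p x = search-upper p x x
  (subst (ℕ._≤ suc x ℕ.^ suc p) (ℕ.*-identityʳ (suc x)) (ℕ.*-monoʳ-≤ (suc x) (1≤[1+n]^p x p)))

^-distribʳ-* : ∀ a b m → (a ℕ.* b) ℕ.^ m ≡ a ℕ.^ m ℕ.* b ℕ.^ m
^-distribʳ-* a b zero    = refl
^-distribʳ-* a b (suc m) = trans (cong (a ℕ.* b ℕ.*_) (^-distribʳ-* a b m))
  (N.solve 4 (λ a b c d → a N.:* b N.:* (c N.:* d) N.:= (a N.:* c) N.:* (b N.:* d)) refl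
    a b (a ℕ.^ m) (b ℕ.^ m))
  where module N = +-*-Solver

^-cancel-< : ∀ {a b} m → a ℕ.^ m ℕ.< b ℕ.^ m → a ℕ.< b
^-cancel-< {a} {b} m h = ℕ.≰⇒> λ b≤a → ℕ.<⇒≱ h (ℕ.^-monoˡ-≤ m b≤a)

/-mono-≤ : ∀ {a b c d} → a ℕ.* suc d ℕ.≤ c ℕ.* suc b → + a / suc b ≤ + c / suc d
/-mono-≤ {a} {b} {c} {d} h = ℚ.toℚᵘ-cancel-≤
  (ℚᵘ.≤-respˡ-≃ (ℚᵘ.≃-sym (ℚ.toℚᵘ-fromℚᵘ (ℚᵘ.mkℚᵘ (+ a) b)))
  (ℚᵘ.≤-respʳ-≃ (ℚᵘ.≃-sym (ℚ.toℚᵘ-fromℚᵘ (ℚᵘ.mkℚᵘ (+ c) d)))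
  (ℚᵘ.*≤* (subst₂ ℤ._≤_ (ℤ.pos-* a (suc d)) (ℤ.pos-* c (suc b)) (ℤ.+≤+ h)))))

/-+ : ∀ a c d → (+ a / suc d) + (+ c / suc d) ≡ + (a ℕ.+ c) / suc d
/-+ a c d = ℚ.toℚᵘ-injective (begin
  ℚ.toℚᵘ ((+ a / suc d) + (+ c / suc d))
    ≈⟨ ℚ.toℚᵘ-homo-+ (+ a / suc d) (+ c / suc d) ⟩
  ℚ.toℚᵘ (+ a / suc d) ℚᵘ.+ ℚ.toℚᵘ (+ c / suc d)
    ≈⟨ ℚᵘ.+-cong (ℚ.toℚᵘ-fromℚᵘ (ℚᵘ.mkℚᵘ (+ a) d)) (ℚ.toℚᵘ-fromℚᵘ (ℚᵘ.mkℚᵘ (+ c) d)) ⟩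
  ℚᵘ.mkℚᵘ (+ a) d ℚᵘ.+ ℚᵘ.mkℚᵘ (+ c) d
    ≈⟨ ℚᵘ.*≡* eq ⟩
  ℚᵘ.mkℚᵘ (+ (a ℕ.+ c)) d
    ≈⟨ ℚ.toℚᵘ-fromℚᵘ (ℚᵘ.mkℚᵘ (+ (a ℕ.+ c)) d) ⟨
  ℚ.toℚᵘ (+ (a ℕ.+ c) / suc d) ∎)
  where
  open ℚᵘ.≃-Reasoning
  eq : (+ a ℤ.* + suc d ℤ.+ + c ℤ.* + suc d) ℤ.* + suc d ≡ + (a ℕ.+ c) ℤ.* (+ suc d ℤ.* + suc d)
  eq = trans (cong (ℤ._* + suc d) (sym (ℤ.*-distribʳ-+ (+ suc d) (+ a) (+ c))))
             (ℤ.*-assoc (+ (a ℕ.+ c)) (+ suc d) (+ suc d))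

archimedean : ∀ ε → 0ℚ < ε → ∃[ N ] (∀ j → N ℕ.≤ j → + 1 / suc j ≤ ε)
archimedean ε@(ℚ.mkℚ (+ suc p) q _) _ = q , λ j j≥q →
  subst (+ 1 / suc j ≤_) (ℚ.fromℚᵘ-toℚᵘ ε)
    (/-mono-≤ {1} {j} {suc p} {q}
      (ℕ.*-mono-≤ {1} {suc p} {suc q} {suc j} (s≤s z≤n) (s≤s j≥q)))
archimedean (ℚ.mkℚ (+ zero) _ _) (ℚ.*<* (ℤ.+<+ ()))
archimedean (ℚ.mkℚ -[1+ _ ] _ _) (ℚ.*<* ())

rootNum : (p t j : ℕ) → ℕ
rootNum p t j = iroot (suc p) (t ℕ.* suc j ℕ.^ suc p)

rootNum-cross : ∀ p t i j → rootNum p t i ℕ.* suc j ℕ.≤ suc (rootNum p t j) ℕ.* suc i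
rootNum-cross p t i j = ℕ.<⇒≤ (^-cancel-< (suc p) (begin-strict
  (a ℕ.* suc j) ℕ.^ suc p                          ≡⟨ ^-distribʳ-* a (suc j) (suc p) ⟩
  a ℕ.^ suc p ℕ.* suc j ℕ.^ suc p                  ≤⟨ ℕ.*-monoˡ-≤ (suc j ℕ.^ suc p) (iroot-lower p (t ℕ.* suc i ℕ.^ suc p)) ⟩
  t ℕ.* suc i ℕ.^ suc p ℕ.* suc j ℕ.^ suc p        ≡⟨ N.solve 3 (λ t x y → t N.:* x N.:* y N.:= t N.:* y N.:* x) refl t (suc i ℕ.^ suc p) (suc j ℕ.^ suc p) ⟩
  t ℕ.* suc j ℕ.^ suc p ℕ.* suc i ℕ.^ suc p        <⟨ ℕ.*-monoˡ-< (suc i ℕ.^ suc p) {{ℕ.>-nonZero (1≤[1+n]^p i (suc p))}} (iroot-upper p (t ℕ.* suc j ℕ.^ suc p)) ⟩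
  suc b ℕ.^ suc p ℕ.* suc i ℕ.^ suc p              ≡⟨ ^-distribʳ-* (suc b) (suc i) (suc p) ⟨
  (suc b ℕ.* suc i) ℕ.^ suc p                      ∎))
  where
  open ℕ.≤-Reasoning
  module N = +-*-Solver
  a = rootNum p t i
  b = rootNum p t j

root-close : ∀ p t i j ε → + 1 / suc j ≤ ε →
  + rootNum p t i / suc i ≤ (+ rootNum p t j / suc j) + ε
root-close p t i j ε h = begin
  + rootNum p t i / suc i                    ≤⟨ /-mono-≤ {rootNum p t i} {i} {rootNum p t j ℕ.+ 1} {j} (subst (λ z → rootNum p t i ℕ.* suc j ℕ.≤ z ℕ.* suc i) (ℕ.+-comm 1 (rootNum p t j)) (rootNum-cross p t i j)) ⟩
  + (rootNum p t j ℕ.+ 1) / suc j            ≡⟨ /-+ (rootNum p t j) 1 j ⟨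
  (+ rootNum p t j / suc j) + (+ 1 / suc j)  ≤⟨ ℚ.+-monoʳ-≤ (+ rootNum p t j / suc j) h ⟩
  (+ rootNum p t j / suc j) + ε              ∎
  where open ℚ.≤-Reasoning

-- root m t = t^(1/m) for m ≥ 1, approximated by ⌊ (j+1) t^(1/m) ⌋ / (j+1).
root : (m t : ℕ) → ℝ
root zero    t = 0ᴿ
root (suc p) t = mkℝ (λ j → + iroot (suc p) (t ℕ.* suc j ℕ.^ suc p) / suc j) λ ε ε>0 →
  let N , h = archimedean ε ε>0
  in N , λ i j i≥ j≥ → ∣p-q∣≤ε (root-close p t i j ε (h j j≥)) (root-close p t j i ε (h i i≥))

bernoulli : ∀ s m → suc s ℕ.^ m ℕ.* suc s ℕ.≤ s ℕ.^ m ℕ.* suc s ℕ.+ m ℕ.* suc s ℕ.^ m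
bernoulli s zero    = ℕ.m≤m+n _ 0
bernoulli s (suc m) = begin
  suc s ℕ.* X ℕ.* suc s                         ≡⟨ ℕ.*-assoc (suc s) X (suc s) ⟩
  suc s ℕ.* (X ℕ.* suc s)                       ≤⟨ ℕ.*-monoʳ-≤ (suc s) (bernoulli s m) ⟩
  suc s ℕ.* (Y ℕ.* suc s ℕ.+ m ℕ.* X)
    ≡⟨ N.solve 4 (λ s m x y → (N.con 1 N.:+ s) N.:* (y N.:* (N.con 1 N.:+ s) N.:+ m N.:* x)
         N.:= s N.:* y N.:* (N.con 1 N.:+ s) N.:+ ((N.con 1 N.:+ s) N.:* y N.:+ m N.:* ((N.con 1 N.:+ s) N.:* x)))
         refl s m X Y ⟩
  s ℕ.* Y ℕ.* suc s ℕ.+ (suc s ℕ.* Y ℕ.+ m ℕ.* (suc s ℕ.* X))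
    ≤⟨ ℕ.+-monoʳ-≤ (s ℕ.* Y ℕ.* suc s) (ℕ.+-monoˡ-≤ (m ℕ.* (suc s ℕ.* X)) (ℕ.*-monoʳ-≤ (suc s) (ℕ.^-monoˡ-≤ m (ℕ.n≤1+n s)))) ⟩
  s ℕ.* Y ℕ.* suc s ℕ.+ (suc s ℕ.* X ℕ.+ m ℕ.* (suc s ℕ.* X))  ∎
  where
  open ℕ.≤-Reasoning
  module N = +-*-Solver
  X = suc s ℕ.^ m
  Y = s ℕ.^ m

-- (1 + 1/s)^m ≤ 2 for s = 2m - 1
[1+1/s]^m≤2 : ∀ p → let s = p ℕ.+ suc p in suc s ℕ.^ suc p ℕ.≤ 2 ℕ.* s ℕ.^ suc p
[1+1/s]^m≤2 p = ℕ.*-cancelˡ-≤ (suc p) (ℕ.+-cancelʳ-≤ (suc p ℕ.* X) (suc p ℕ.* X) (suc p ℕ.* (2 ℕ.* Y)) (begin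
  suc p ℕ.* X ℕ.+ suc p ℕ.* X              ≡⟨ N.solve 2 (λ p x → (N.con 1 N.:+ p) N.:* x N.:+ (N.con 1 N.:+ p) N.:* x N.:= x N.:* (N.con 1 N.:+ (p N.:+ (N.con 1 N.:+ p)))) refl p X ⟩
  X ℕ.* suc s                              ≤⟨ bernoulli s (suc p) ⟩
  Y ℕ.* suc s ℕ.+ suc p ℕ.* X              ≡⟨ N.solve 3 (λ p x y → y N.:* (N.con 1 N.:+ (p N.:+ (N.con 1 N.:+ p))) N.:+ (N.con 1 N.:+ p) N.:* x N.:= (N.con 1 N.:+ p) N.:* (N.con 2 N.:* y) N.:+ (N.con 1 N.:+ p) N.:* x) refl p X Y ⟩
  suc p ℕ.* (2 ℕ.* Y) ℕ.+ suc p ℕ.* X      ∎))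
  where
  open ℕ.≤-Reasoning
  module N = +-*-Solver
  s = p ℕ.+ suc p
  X = suc s ℕ.^ suc p
  Y = s ℕ.^ suc p

rootNum-gap : ∀ p t j → 2 ℕ.≤ t → let s = p ℕ.+ suc p in
  suc s ℕ.* suc j ℕ.≤ s ℕ.* suc (rootNum p t j)
rootNum-gap p t j t≥2 = ℕ.<⇒≤ (^-cancel-< (suc p) (begin-strict
  (suc s ℕ.* suc j) ℕ.^ suc p                  ≡⟨ ^-distribʳ-* (suc s) (suc j) (suc p) ⟩
  suc s ℕ.^ suc p ℕ.* J                        ≤⟨ ℕ.*-monoˡ-≤ J ([1+1/s]^m≤2 p) ⟩
  2 ℕ.* S ℕ.* J                                ≤⟨ ℕ.*-monoˡ-≤ J (ℕ.*-monoˡ-≤ S t≥2) ⟩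
  t ℕ.* S ℕ.* J                                ≡⟨ N.solve 3 (λ t x y → t N.:* x N.:* y N.:= x N.:* (t N.:* y)) refl t S J ⟩
  S ℕ.* (t ℕ.* J)                              <⟨ ℕ.*-monoʳ-< S {{S≢0}} (iroot-upper p (t ℕ.* J)) ⟩
  S ℕ.* suc (rootNum p t j) ℕ.^ suc p          ≡⟨ ^-distribʳ-* s (suc (rootNum p t j)) (suc p) ⟨
  (s ℕ.* suc (rootNum p t j)) ℕ.^ suc p        ∎))
  where
  open ℕ.≤-Reasoning
  module N = +-*-Solver
  s = p ℕ.+ suc p
  J = suc j ℕ.^ suc p
  S = s ℕ.^ suc p
  s≡ : s ≡ suc (p ℕ.+ p)
  s≡ = ℕ.+-suc p p
  S≢0 : ℕ.NonZero S
  S≢0 = ℕ.>-nonZero (subst (λ z → 1 ℕ.≤ z ℕ.^ suc p) (sym s≡) (1≤[1+n]^p (p ℕ.+ p) (suc p)))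

root-1≥ : ∀ p t j → 2 ℕ.≤ t → let s = p ℕ.+ suc p in 2 ℕ.* s ℕ.≤ suc j →
  + 1 / suc (2 ℕ.* (p ℕ.+ p) ℕ.+ 1) ≤ (+ rootNum p t j / suc j) - + 1 / 1
root-1≥ p t j t≥2 j≥ = subst (_≤ (+ a / suc j) - 1ℚ)
  (solve 1 (λ x → (con 1ℚ ⊕ x) ⊕ ⊝ con 1ℚ := x) refl (+ 1 / suc d))
  (ℚ.+-monoˡ-≤ (- 1ℚ) (ℚ.≤-trans step₁ (/-mono-≤ {suc (suc d)} {d} {a} {j} step₂)))
  where
  module N = +-*-Solver
  d = 2 ℕ.* (p ℕ.+ p) ℕ.+ 1
  a = rootNum p t j
  s = p ℕ.+ suc p
  1≤ : 1ℚ ≤ + suc d / suc d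
  1≤ = /-mono-≤ {1} {0} {suc d} {d} (ℕ.≤-reflexive (ℕ.*-comm 1 (suc d)))
  step₁ : 1ℚ + (+ 1 / suc d) ≤ + suc (suc d) / suc d
  step₁ = ℚ.≤-trans (ℚ.+-monoˡ-≤ (+ 1 / suc d) 1≤)
    (ℚ.≤-reflexive (trans (/-+ (suc d) 1 d) (cong (λ z → + z / suc d) (ℕ.+-comm (suc d) 1))))
  step₂ : suc (suc d) ℕ.* suc j ℕ.≤ a ℕ.* suc d
  step₂ = ℕ.+-cancelʳ-≤ (suc d) _ _ (begin
    suc (suc d) ℕ.* suc j ℕ.+ suc d       ≤⟨ ℕ.+-monoʳ-≤ (suc (suc d) ℕ.* suc j) (subst (ℕ._≤ suc j) (N.solve 1 (λ p → N.con 2 N.:* (p N.:+ (N.con 1 N.:+ p)) N.:= N.con 1 N.:+ (N.con 2 N.:* (p N.:+ p) N.:+ N.con 1)) refl p) j≥) ⟩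
    suc (suc d) ℕ.* suc j ℕ.+ suc j       ≡⟨ N.solve 2 (λ p j → (N.con 2 N.:+ (N.con 2 N.:* (p N.:+ p) N.:+ N.con 1)) N.:* j N.:+ j N.:= N.con 2 N.:* ((N.con 1 N.:+ (p N.:+ (N.con 1 N.:+ p))) N.:* j)) refl p (suc j) ⟩
    2 ℕ.* (suc s ℕ.* suc j)               ≤⟨ ℕ.*-monoʳ-≤ 2 (rootNum-gap p t j t≥2) ⟩
    2 ℕ.* (s ℕ.* suc a)                   ≡⟨ N.solve 2 (λ p a → N.con 2 N.:* ((p N.:+ (N.con 1 N.:+ p)) N.:* (N.con 1 N.:+ a)) N.:= a N.:* (N.con 1 N.:+ (N.con 2 N.:* (p N.:+ p) N.:+ N.con 1)) N.:+ (N.con 1 N.:+ (N.con 2 N.:* (p N.:+ p) N.:+ N.con 1))) refl p a ⟩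
    a ℕ.* suc d ℕ.+ suc d                 ∎)
    where open ℕ.≤-Reasoning

root-1>0 : ∀ {m t} → 1 ℕ.≤ m → 2 ℕ.≤ t → 0ᴿ <ᴿ root m t -ᴿ 1ᴿ
root-1>0 {suc p} {t} _ t≥2 =
  + 1 / suc (2 ℕ.* (p ℕ.+ p) ℕ.+ 1)
  , ℚ.positive⁻¹ _ {{ℚ.normalize-pos 1 (suc (2 ℕ.* (p ℕ.+ p) ℕ.+ 1))}}
  , 2 ℕ.* (p ℕ.+ suc p)
  , λ j j≥ → subst (_≤ (+ rootNum p t j / suc j) - 1ℚ) (sym (ℚ.+-identityˡ _))
      (root-1≥ p t j t≥2 (ℕ.m≤n⇒m≤1+n j≥))

IsMinimum : {P : ℕ → Set} → (∀ t → P t → ℝ) → ℝ → Set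
IsMinimum {P} g μ =
  (∃[ t ] Σ (P t) λ p → g t p ≃ᴿ μ) × (∀ t (p : P t) → μ ≤ᴿ g t p)

n[k-1]+1≥2 : ∀ {n k t} → 2 ℕ.≤ n → 2 ℕ.≤ k → n ℕ.* (k ℕ.∸ 1) ℕ.+ 1 ℕ.≤ t → 2 ℕ.≤ t
n[k-1]+1≥2 {n} {k} 2≤n 2≤k h = ℕ.≤-trans
  (ℕ.+-monoˡ-≤ 1 (ℕ.*-mono-≤ {1} {n} {1} {k ℕ.∸ 1} (ℕ.≤-trans (s≤s z≤n) 2≤n) (ℕ.∸-monoˡ-≤ 1 2≤k))) h

{-# OPTIONS --safe #-}

-- Put h = k - 1. In a graph without odd cycles of length at most 2k - 1 every ball of radius at most h is bipartite,
-- with its spheres coloured alternately. Take a graph G on f(n,k) + 1 vertices.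
--   * If some ball of radius h has at least f(n,k) + 1 - f(n-1,k) vertices, then its complement is (n-1)-colourable;
--     the new colour on the last sphere, alternating with an old one further in, gives an n-colouring of G.
--   * If some ball of radius h has at most nh vertices, then it has a sphere with fewer than n vertices. An n-colouring
--     of what lies on and outside that sphere leaves a colour unused on it, which is used to colour the inside.
--   * Otherwise all balls of radius h have at most t = f(n,k) - f(n-1,k) vertices, so each of them has two consecutive
--     radii between which it grows by a factor at most t^(1/h). Cutting off such balls one by one gives a bipartite
--     graph and a set of at most (1 - t^(-1/h)) |G| separating vertices. If the latter is at most f(n-2,k), then G is
--     n-colourable.
-- As not every such G is n-colourable, t ≥ nh + 1 and both terms of the maximum are at most f(n,k) for this t.
-- The minimum over t exists because the comparison of the second term with an integer is decidable.

module Submission where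

open import Data.Product using (Σ; ∃-syntax; _×_; _,_; proj₁; proj₂)
open import Data.Sum using (_⊎_; inj₁; inj₂)
open import Function using (_∘_)
open import Function.Definitions using (Injective)
open import Level using (0ℓ)
open import Relation.Binary.PropositionalEquality hiding (J)
open import Relation.Nullary using (¬_; Dec; yes; no; does; contradiction; _×-dec_)
open import Relation.Unary using (Pred; Decidable)

module Coloring where

  open import Data.Nat using (ℕ; zero; suc; _+_; _*_; _∸_; _^_; _≤_; _<_; z≤n; s≤s; s≤s⁻¹; parity; _≤?_; _<?_)
  open import Data.Nat.Properties
  open import Data.Nat.Divisibility using (_∣_; divides)
  open import Data.Nat.Induction using (<-wellFounded)
  open import Data.Bool using (true; if_then_else_)
  open import Data.Fin as Fin using (Fin; zero; suc; inject₁; fromℕ; _↑ʳ_)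
  import Data.Fin.Properties as Fin
  open import Data.Fin.Subset
  open import Data.Fin.Subset.Properties
  open import Data.Parity.Base as ℙ using (Parity; 0ℙ; 1ℙ; _⁻¹)
  import Data.Parity.Properties as ℙ
  open import Data.Vec using ([]; _∷_; tabulate; here; there)
  open import Data.Vec.Properties using (lookup∘tabulate; lookup⇒[]=; []=⇒lookup)
  open import Induction.WellFounded using (Acc; acc)
  open import Defs using (Graph; Cycle; NoOddCycle≤; Colorable; ForcesColorable; f[_,_]≡_)

  private variable
    m n a b ℓ : ℕ

  -- Subsets of a finite set: comprehension, cardinality, enumeration

  ⟪_⟫ : {P : Pred (Fin m) 0ℓ} → Decidable P → Subset m
  ⟪ P? ⟫ = tabulate (does ∘ P?)

  module _ {P : Pred (Fin m) 0ℓ} (P? : Decidable P) where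

    ∈⟪⟫⁺ : ∀ {x} → P x → x ∈ ⟪ P? ⟫
    ∈⟪⟫⁺ {x} Px = lookup⇒[]= x _ (trans (lookup∘tabulate (does ∘ P?) x) eq)
      where
      eq : does (P? x) ≡ true
      eq with P? x
      ... | yes _  = refl
      ... | no ¬Px = contradiction Px ¬Px

    ∈⟪⟫⁻ : ∀ {x} → x ∈ ⟪ P? ⟫ → P x
    ∈⟪⟫⁻ {x} x∈ with P? x | trans (sym (lookup∘tabulate (does ∘ P?) x)) ([]=⇒lookup x∈)
    ... | yes Px | _ = Px

  ∣p─q∣+∣q∣≡∣p∣ : ∀ (p q : Subset m) → q ⊆ p → ∣ p ─ q ∣ + ∣ q ∣ ≡ ∣ p ∣
  ∣p─q∣+∣q∣≡∣p∣ []            []            _   = refl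
  ∣p─q∣+∣q∣≡∣p∣ (outside ∷ p) (outside ∷ q) q⊆p = ∣p─q∣+∣q∣≡∣p∣ p q (drop-∷-⊆ q⊆p)
  ∣p─q∣+∣q∣≡∣p∣ (inside  ∷ p) (outside ∷ q) q⊆p = cong suc (∣p─q∣+∣q∣≡∣p∣ p q (drop-∷-⊆ q⊆p))
  ∣p─q∣+∣q∣≡∣p∣ (inside  ∷ p) (inside  ∷ q) q⊆p =
    trans (+-suc ∣ p ─ q ∣ ∣ q ∣) (cong suc (∣p─q∣+∣q∣≡∣p∣ p q (drop-∷-⊆ q⊆p)))
  ∣p─q∣+∣q∣≡∣p∣ (outside ∷ p) (inside  ∷ q) q⊆p with () ← q⊆p here

  ∣p∪q∣≡∣p∣+∣q∣ : ∀ (p q : Subset m) → (∀ {x} → x ∈ p → x ∉ q) → ∣ p ∪ q ∣ ≡ ∣ p ∣ + ∣ q ∣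
  ∣p∪q∣≡∣p∣+∣q∣ []            []            _   = refl
  ∣p∪q∣≡∣p∣+∣q∣ (outside ∷ p) (outside ∷ q) p#q = ∣p∪q∣≡∣p∣+∣q∣ p q (λ x∈p x∈q → p#q (there x∈p) (there x∈q))
  ∣p∪q∣≡∣p∣+∣q∣ (inside  ∷ p) (outside ∷ q) p#q =
    cong suc (∣p∪q∣≡∣p∣+∣q∣ p q (λ x∈p x∈q → p#q (there x∈p) (there x∈q)))
  ∣p∪q∣≡∣p∣+∣q∣ (outside ∷ p) (inside  ∷ q) p#q =
    trans (cong suc (∣p∪q∣≡∣p∣+∣q∣ p q (λ x∈p x∈q → p#q (there x∈p) (there x∈q)))) (sym (+-suc ∣ p ∣ ∣ q ∣))
  ∣p∪q∣≡∣p∣+∣q∣ (inside  ∷ p) (inside  ∷ q) p#q = contradiction here (p#q here)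

  x∈p─q⇒x∉q : ∀ {x} (p q : Subset m) → x ∈ p ─ q → x ∉ q
  x∈p─q⇒x∉q (_ ∷ p) (outside ∷ q) (there x∈) (there x∈q) = x∈p─q⇒x∉q p q x∈ x∈q
  x∈p─q⇒x∉q (_ ∷ p) (inside ∷ q)  (there x∈) (there x∈q) = x∈p─q⇒x∉q p q x∈ x∈q

  -- Numbers the members of `p` in increasing order, so that an induced subgraph has a vertex set of
  -- the form `Fin ∣ p ∣`, as `ForcesColorable` demands.
  element : (p : Subset m) → Fin ∣ p ∣ → Fin m
  element (inside  ∷ p) zero    = zero
  element (inside  ∷ p) (suc i) = suc (element p i)
  element (outside ∷ p) i       = suc (element p i)

  element-injective : (p : Subset m) → Injective _≡_ _≡_ (element p)
  element-injective (inside  ∷ p) {zero}  {zero}  _  = refl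
  element-injective (inside  ∷ p) {suc i} {suc j} eq = cong suc (element-injective p (Fin.suc-injective eq))
  element-injective (outside ∷ p)                 eq = element-injective p (Fin.suc-injective eq)

  index : ∀ {p : Subset m} {x} → x ∈ p → Fin ∣ p ∣
  index {p = inside  ∷ p} here       = zero
  index {p = inside  ∷ p} (there x∈) = suc (index x∈)
  index {p = outside ∷ p} (there x∈) = index x∈

  element-index : ∀ {p : Subset m} {x} (x∈p : x ∈ p) → element p (index x∈p) ≡ x
  element-index {p = inside  ∷ p} here       = refl
  element-index {p = inside  ∷ p} (there x∈) = cong suc (element-index x∈)
  element-index {p = outside ∷ p} (there x∈) = cong suc (element-index x∈)

  -- Induced subgraphs, walks and the parity of short closed walks

  parity≡1ℙ⇒odd : ∀ n → parity n ≡ 1ℙ → ¬ 2 ∣ n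
  parity≡1ℙ⇒odd _ odd (divides q refl) with trans (sym odd) (trans (ℙ.*-homo-* q 2) (ℙ.*-zeroʳ (parity q)))
  ... | ()

  module _ (G : Graph m) where
    open Graph G

    induced : (p : Subset m) → Graph ∣ p ∣
    induced p = record
      { _~_      = λ i j → element p i ~ element p j
      ; ~-sym    = ~-sym
      ; ~-irrefl = λ eq → ~-irrefl (cong (element p) eq)
      ; _~?_     = λ i j → element p i ~? element p j
      }

    induced-cycle : ∀ p → Cycle (induced p) ℓ → Cycle G ℓ
    induced-cycle p C = record
      { vertex   = element p ∘ vertex
      ; distinct = distinct ∘ element-injective p
      ; step     = step
      ; close    = close
      ; length≥3 = length≥3
      } where open Cycle C

    data Walk : Fin m → Fin m → ℕ → Set where
      []  : ∀ {u} → Walk u u 0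
      _∷_ : ∀ {u w v} → u ~ w → Walk w v ℓ → Walk u v (suc ℓ)

    private variable
      u v w x y : Fin m

    _++_ : Walk u v a → Walk v w b → Walk u w (a + b)
    []       ++ q = q
    (e ∷ p) ++ q = e ∷ (p ++ q)

    _∷ʳ_ : Walk u v ℓ → v ~ w → Walk u w (suc ℓ)
    []      ∷ʳ f = f ∷ []
    (e ∷ p) ∷ʳ f = e ∷ (p ∷ʳ f)

    reverse : Walk u v ℓ → Walk v u ℓ
    reverse []      = []
    reverse (e ∷ p) = reverse p ∷ʳ ~-sym e

    vertexAt : Walk u v ℓ → Fin (suc ℓ) → Fin m
    vertexAt {u = u} _ zero    = u
    vertexAt (_ ∷ p)   (suc i) = vertexAt p i

    vertexAt-step : (p : Walk u v ℓ) (i : Fin ℓ) → vertexAt p (inject₁ i) ~ vertexAt p (suc i)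
    vertexAt-step (e ∷ [])      zero    = e
    vertexAt-step (e ∷ (_ ∷ _)) zero    = e
    vertexAt-step (_ ∷ p)       (suc i) = vertexAt-step p i

    vertexAt-last : (p : Walk u v ℓ) → vertexAt p (fromℕ ℓ) ≡ v
    vertexAt-last []      = refl
    vertexAt-last (_ ∷ p) = vertexAt-last p

    split : (p : Walk u v ℓ) (i : Fin (suc ℓ)) →
      ∃[ a ] ∃[ b ] Walk u (vertexAt p i) a × Walk (vertexAt p i) v b × a + b ≡ ℓ
    split p       zero    = 0 , _ , [] , p , refl
    split (e ∷ p) (suc i) with split p i
    ... | a , b , q , r , a+b≡ℓ = suc a , b , e ∷ q , r , cong suc a+b≡ℓ

    -- The walk is cut at both visits to a repeated vertex `x`; `suc b` makes the closed part
    -- between them nonempty.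
    Detour : Fin m → Fin m → ℕ → Set
    Detour u v ℓ = ∃[ x ] ∃[ a ] ∃[ b ] ∃[ c ]
      Walk u x a × Walk x x (suc b) × Walk x v c × a + (suc b + c) ≡ ℓ

    simple-or-detour : (p : Walk u v ℓ) → Injective _≡_ _≡_ (vertexAt p) ⊎ Detour u v ℓ
    simple-or-detour [] = inj₁ λ { {zero} {zero} _ → refl }
    simple-or-detour {u = u} (e ∷ p) with simple-or-detour p
    ... | inj₂ (x , a , b , c , q , r , s , eq) = inj₂ (x , suc a , b , c , e ∷ q , r , s , cong suc eq)
    ... | inj₁ simple with Fin.any? (λ i → vertexAt p i Fin.≟ u)
    ...   | no u∉p = inj₁ λ
              { {zero}  {zero}  _  → refl
              ; {zero}  {suc j} eq → contradiction (j , sym eq) u∉p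
              ; {suc i} {zero}  eq → contradiction (i , eq) u∉p
              ; {suc i} {suc j} eq → cong suc (simple eq)
              }
    ...   | yes (i , refl) with split p i
    ...     | b , c , q , r , eq = inj₂ (_ , 0 , b , c , [] , e ∷ q , r , cong suc eq)

    module _ {L : ℕ} (noOdd : NoOddCycle≤ L G) where

      -- Strong induction on the length. If the walk without its first edge repeats no vertex, the
      -- closed walk is a cycle or has length at most 2. Otherwise a detour splits it into two
      -- shorter closed walks, both even.
      closedWalk-even : Acc _<_ ℓ → Walk x x ℓ → ℓ ≤ L → parity ℓ ≡ 0ℙ
      closedWalk-even _ [] _ = refl
      closedWalk-even {suc ℓ} (acc rec) (e ∷ p) ℓ≤L with simple-or-detour p
      closedWalk-even {1} _ (e ∷ []) _ | _ = contradiction e (~-irrefl refl)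
      closedWalk-even {2} _ _ _ | _ = refl
      -- `parity` recurses in steps of two, so for length ℓ + 3 the goal has reduced to
      -- `parity (suc ℓ)`.
      closedWalk-even {suc (suc (suc ℓ))} _ (e ∷ p) ℓ≤L | inj₁ simple with parity (suc ℓ) in eq
      ... | 0ℙ = refl
      ... | 1ℙ = contradiction C (noOdd (suc (suc ℓ)) ℓ≤L (parity≡1ℙ⇒odd (suc (suc (suc ℓ))) eq))
        where
        C : Cycle G (suc (suc ℓ))
        C = record
          { vertex   = vertexAt p
          ; distinct = simple
          ; step     = vertexAt-step p
          ; close    = subst (_~ _) (sym (vertexAt-last p)) e
          ; length≥3 = s≤s (s≤s (s≤s z≤n))
          }
      closedWalk-even {suc ℓ} (acc rec) (e ∷ p) ℓ≤L | inj₂ (_ , a , b , c , q , r , s , a+1+b+c≡ℓ) = begin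
        parity (suc ℓ)                           ≡⟨ cong (parity ∘ suc) a+1+b+c≡ℓ ⟨
        parity (suc a + (suc b + c))             ≡⟨ ℙ.+-homo-+ (suc a) (suc b + c) ⟩
        parity (suc a) ℙ.+ parity (suc b + c)
          ≡⟨ cong (parity (suc a) ℙ.+_) (trans (ℙ.+-homo-+ (suc b) c) (cong (ℙ._+ parity c) even₁)) ⟩
        parity (suc a) ℙ.+ parity c              ≡⟨ ℙ.+-homo-+ (suc a) c ⟨
        parity (suc (a + c))
          ≡⟨ closedWalk-even (rec shorter₂) (e ∷ (q ++ s)) (≤-trans (<⇒≤ shorter₂) ℓ≤L) ⟩
        0ℙ                                       ∎
        where
        open ≡-Reasoning
        shorter₁ : suc b < suc ℓ
        shorter₁ = s≤s (subst (suc b ≤_) a+1+b+c≡ℓ (≤-trans (m≤m+n (suc b) c) (m≤n+m _ a)))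
        shorter₂ : suc (a + c) < suc ℓ
        shorter₂ = s≤s (subst (a + c <_) a+1+b+c≡ℓ (+-monoʳ-< a (s≤s (m≤n+m c b))))
        even₁ : parity (suc b) ≡ 0ℙ
        even₁ = closedWalk-even (rec shorter₁) r (≤-trans (<⇒≤ shorter₁) ℓ≤L)

    -- Balls and the alternating colouring of their spheres

    neighbour? : (p : Subset m) → Decidable (λ x → ∃[ y ] y ∈ p × y ~ x)
    neighbour? p x = Fin.any? λ y → (y ∈? p) ×-dec (y ~? x)

    module _ (R : Subset m) (v : Fin m) where

      -- Balls are taken inside `R` because `grow` works in what remains after earlier balls have
      -- been removed; balls of `G` are the case `R = ⊤`.
      ball : ℕ → Subset m
      ball zero    = ⁅ v ⁆
      ball (suc i) = ball i ∪ R ∩ ⟪ neighbour? (ball i) ⟫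

      ball⊆ball-suc : ∀ i → ball i ⊆ ball (suc i)
      ball⊆ball-suc i = p⊆p∪q _

      neighbour∈ball-suc : ∀ i → x ∈ ball i → y ∈ R → x ~ y → y ∈ ball (suc i)
      neighbour∈ball-suc i x∈B y∈R x~y =
        q⊆p∪q (ball i) _ (x∈p∩q⁺ (y∈R , ∈⟪⟫⁺ (neighbour? (ball i)) (_ , x∈B , x~y)))

      ball-suc⁻ : ∀ i → y ∈ ball (suc i) → y ∈ ball i ⊎ (y ∈ R × ∃[ x ] x ∈ ball i × x ~ y)
      ball-suc⁻ i y∈ with x∈p∪q⁻ (ball i) _ y∈
      ... | inj₁ y∈B = inj₁ y∈B
      ... | inj₂ y∈′ with x∈p∩q⁻ R _ y∈′
      ...   | y∈R , y∈N = inj₂ (y∈R , ∈⟪⟫⁻ (neighbour? (ball i)) y∈N)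

      ball⊆ : v ∈ R → ∀ i → ball i ⊆ R
      ball⊆ v∈R zero    x∈ rewrite x∈⁅y⁆⇒x≡y v x∈ = v∈R
      ball⊆ v∈R (suc i) x∈ with ball-suc⁻ i x∈
      ... | inj₁ x∈B       = ball⊆ v∈R i x∈B
      ... | inj₂ (x∈R , _) = x∈R

      center∈ball : ∀ i → v ∈ ball i
      center∈ball zero    = x∈⁅x⁆ v
      center∈ball (suc i) = ball⊆ball-suc i (center∈ball i)

      -- Colours the spheres around v alternately, the outermost one by 0ℙ.
      side : ℕ → Fin m → Parity
      side zero    x = 0ℙ
      side (suc i) x = if does (x ∈? ball i) then side i x ⁻¹ else 0ℙ

      -- A vertex of the next smaller ball has all its neighbours from `R` in this ball, so `x` lies
      -- on the last sphere.
      side-boundary : ∀ i → x ∈ ball i → y ∈ R → x ~ y → y ∉ ball i → side i x ≡ 0ℙ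
      side-boundary zero x∈ y∈R x~y y∉ = refl
      side-boundary {x} (suc i) x∈ y∈R x~y y∉ with x ∈? ball i
      ... | yes x∈B = contradiction (neighbour∈ball-suc i x∈B y∈R x~y) y∉
      ... | no  _   = refl

      -- Ties the colour to the length of a walk from the centre, so that parities of closed walks
      -- apply. Enlarging the radius flips both sides of the equation for an old vertex; a new one
      -- is reached from the previous last sphere, where `side` is 0ℙ.
      side-walk : v ∈ R → ∀ i → x ∈ ball i → ∃[ ℓ ] ℓ ≤ i × Walk v x ℓ × side i x ≡ parity (i + ℓ)
      side-walk v∈R zero x∈ rewrite x∈⁅y⁆⇒x≡y v x∈ = 0 , z≤n , [] , refl
      side-walk {x} v∈R (suc i) x∈ with x ∈? ball i
      ... | yes x∈B with side-walk v∈R i x∈B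
      ...   | ℓ , ℓ≤i , p , eq = ℓ , m≤n⇒m≤1+n ℓ≤i , p ,
                trans (cong _⁻¹ (trans eq (sym (ℙ.suc-homo-⁻¹ (i + ℓ))))) (ℙ.⁻¹-involutive _)
      side-walk {x} v∈R (suc i) x∈ | no x∉B with ball-suc⁻ i x∈
      ... | inj₁ x∈B = contradiction x∈B x∉B
      ... | inj₂ (x∈R , y , y∈B , y~x) with side-walk v∈R i y∈B
      ...   | ℓ , ℓ≤i , p , eq = suc ℓ , s≤s ℓ≤i , p ∷ʳ y~x ,
                trans (sym (side-boundary i y∈B x∈R y~x x∉B)) (trans eq (cong (parity ∘ suc) (sym (+-suc i ℓ))))

      -- If adjacent vertices had the same colour, their walks from `v` would have lengths of equal
      -- parity. Together with the edge they would form an odd closed walk of length at most i + (i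
      -- + 1).
      side-proper : ∀ {L} → NoOddCycle≤ L G → v ∈ R → ∀ i → i + suc i ≤ L →
        x ∈ ball i → y ∈ ball i → x ~ y → side i x ≢ side i y
      side-proper noOdd v∈R i i+1+i≤L x∈ y∈ x~y eq
        with a , a≤i , p , eq₁ ← side-walk v∈R i x∈ | b , b≤i , q , eq₂ ← side-walk v∈R i y∈ =
        ℙ.p≢p⁻¹ (parity a) (ℙ.+-cancelˡ-≡ (parity a) _ _ (begin
          parity a ℙ.+ parity a        ≡⟨ ℙ.p+p≡0ℙ (parity a) ⟩
          0ℙ                           ≡⟨ closedWalk-even noOdd (<-wellFounded _) (p ++ (x~y ∷ reverse q))
                                            (≤-trans (+-mono-≤ a≤i (s≤s b≤i)) i+1+i≤L) ⟨
          parity (a + suc b)           ≡⟨ ℙ.+-homo-+ a (suc b) ⟩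
          parity a ℙ.+ parity (suc b)
            ≡⟨ cong (parity a ℙ.+_) (trans (sym (ℙ.⁻¹-involutive _)) (cong _⁻¹ (trans (ℙ.suc-homo-⁻¹ b) (sym a≡b)))) ⟩
          parity a ℙ.+ parity a ⁻¹     ∎))
        where
        open ≡-Reasoning
        a≡b : parity a ≡ parity b
        a≡b = ℙ.+-cancelˡ-≡ (parity i) _ _
          (trans (sym (ℙ.+-homo-+ i a)) (trans (sym eq₁) (trans eq (trans eq₂ (ℙ.+-homo-+ i b)))))

  -- Slowly growing sequences

  small-step : ∀ (u : ℕ → ℕ) n h → u 0 ≡ 1 → u h < n * h + 1 → ∃[ i ] i < h × u (suc i) < u i + n
  small-step u n zero    u₀≡1 u<
    rewrite u₀≡1 | *-zeroʳ n = contradiction u< (n≮n 1)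
  small-step u n (suc h) u₀≡1 u< with u (suc h) <? u h + n
  ... | yes small = h , ≤-refl , small
  -- A last step of at least `n` can be subtracted from the hypothesis, which thus passes on to `h`.
  ... | no  big with small-step u n h u₀≡1 (+-cancelʳ-< n (u h) (n * h + 1) (begin-strict
      u h + n          ≤⟨ ≮⇒≥ big ⟩
      u (suc h)        <⟨ u< ⟩
      n * suc h + 1    ≡⟨ cong (_+ 1) (trans (*-suc n h) (+-comm n (n * h))) ⟩
      n * h + n + 1    ≡⟨ +-assoc (n * h) n 1 ⟩
      n * h + (n + 1)  ≡⟨ cong (n * h +_) (+-comm n 1) ⟩
      n * h + (1 + n)  ≡⟨ +-assoc (n * h) 1 n ⟨
      n * h + 1 + n    ∎))
      where open ≤-Reasoning
  ...   | i , i<h , small = i , m≤n⇒m≤1+n i<h , small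

  -- The multiplicative counterpart of `small-step`: growth by at least `N / D` in every step would
  -- give u h ≥ (N / D)^h. Cross-multiplying avoids h-th roots.
  slow-step : ∀ (u : ℕ → ℕ) N D h → u 0 ≡ 1 → u h * D ^ h < N ^ h →
    ∃[ i ] i < h × u (suc i) * D < N * u i
  slow-step u N D zero    u₀≡1 u< rewrite u₀≡1 = contradiction u< (n≮n 1)
  slow-step u N D (suc h) u₀≡1 u< with u (suc h) * D <? N * u h
  ... | yes slow = h , ≤-refl , slow
  ... | no  fast with slow-step u N D h u₀≡1 (*-cancelˡ-< N _ _ (begin-strict
      N * (u h * D ^ h)          ≡⟨ *-assoc N (u h) (D ^ h) ⟨
      N * u h * D ^ h            ≤⟨ *-monoˡ-≤ (D ^ h) (≮⇒≥ fast) ⟩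
      u (suc h) * D * D ^ h      ≡⟨ *-assoc (u (suc h)) D (D ^ h) ⟩
      u (suc h) * (D * D ^ h)    <⟨ u< ⟩
      N * N ^ h                  ∎))
      where open ≤-Reasoning
  ...   | i , i<h , slow = i , m≤n⇒m≤1+n i<h , slow

  select : ∀ {A : Set} → A → A → Parity → A
  select α β 0ℙ = α
  select α β 1ℙ = β

  select-injective : ∀ {A : Set} {α β : A} → α ≢ β → ∀ p q → select α β p ≡ select α β q → p ≡ q
  select-injective _   0ℙ 0ℙ _  = refl
  select-injective _   1ℙ 1ℙ _  = refl
  select-injective α≢β 0ℙ 1ℙ eq = contradiction eq α≢β
  select-injective α≢β 1ℙ 0ℙ eq = contradiction (sym eq) α≢β

  -- Colourings of vertex subsets and their extension to the whole graph

  module _ (G : Graph m) where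
    open Graph G

    -- Colours are given only for members, so that the empty set is colourable with n = 0 colours
    -- even if `m` is positive. This case arises for n - 2 when n = 2.
    ColorableOn : ℕ → Subset m → Set
    ColorableOn n p = Σ (∀ u → u ∈ p → Fin n) λ color →
      ∀ u v u∈p v∈p → u ~ v → color u u∈p ≢ color v v∈p

    colorableOn : ∀ {n k f} → ForcesColorable n k f → NoOddCycle≤ (2 * k ∸ 1) G →
      ∀ p → ∣ p ∣ ≤ f → ColorableOn n p
    colorableOn forces noOdd p ∣p∣≤f
      with c , proper ← forces (induced G p) (λ ℓ ℓ≤ odd C → noOdd ℓ ℓ≤ odd (induced-cycle G p C)) ∣p∣≤f =
      (λ u u∈p → c (index u∈p)) ,
      λ u v u∈p v∈p u~v → proper _ _ (subst₂ _~_ (sym (element-index u∈p)) (sym (element-index v∈p)) u~v)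

    ProperOn : Subset m → (Fin m → Fin n) → Set
    ProperOn p color = ∀ u v → u ∈ p → v ∈ p → u ~ v → color u ≢ color v

    total : ∀ {p} → ColorableOn (suc n) p → Σ (Fin m → Fin (suc n)) (ProperOn p)
    total {n} {p} (c , proper) = c′ , proper′
      where
      c′ : Fin m → Fin (suc n)
      c′ u with u ∈? p
      ... | yes u∈p = c u u∈p
      ... | no  _   = zero
      proper′ : ProperOn p c′
      proper′ u v u∈p v∈p u~v eq with u ∈? p | v ∈? p
      ... | yes u∈ | yes v∈ = proper u v u∈ v∈ u~v eq
      ... | no u∉  | _      = u∉ u∈p
      ... | _      | no v∉  = v∉ v∈p

    -- Carries the size bound on balls of `G` over to balls in the remainder of `G`.
    ball-mono : ∀ R v i → ball G R v i ⊆ ball G ⊤ v i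
    ball-mono R v zero    x∈ = x∈
    ball-mono R v (suc i) x∈ with ball-suc⁻ G R v i x∈
    ... | inj₁ x∈B                 = ball⊆ball-suc G ⊤ v i (ball-mono R v i x∈B)
    ... | inj₂ (_ , y , y∈B , y~x) = neighbour∈ball-suc G ⊤ v i (ball-mono R v i y∈B) ∈⊤ y~x

    -- A two-coloured part holding at least the share D / N of `R`. The weak inequality covers the
    -- empty remainder at which the recursion ends; the strict one is used for the final count.
    record Growth (N D : ℕ) (R : Subset m) : Set where
      field
        interior    : Subset m
        interior⊆   : interior ⊆ R
        color       : Fin m → Parity
        proper      : ∀ x y → x ∈ interior → y ∈ interior → x ~ y → color x ≢ color y
        dense       : ∣ R ∣ * D ≤ N * ∣ interior ∣
        dense-strict : Nonempty R → ∣ R ∣ * D < N * ∣ interior ∣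

    module _ {L : ℕ} (noOdd : NoOddCycle≤ L G) where

      -- Ball vertices with a neighbour outside all have side 0ℙ, hence colour `α`. So only `α` can
      -- clash with `c`, while `β` may occur outside as well.
      extend-over-ball : ∀ v i → i + suc i ≤ L → let B = ball G ⊤ v i in
        (c : Fin m → Fin n) → ProperOn (∁ B) c →
        ∀ α β → α ≢ β → (∀ x y → x ∈ B → y ∉ B → x ~ y → c y ≢ α) → Colorable n G
      extend-over-ball {n} v i i+1+i≤L c proper α β α≢β avoids = c′ , proper′
        where
        B = ball G ⊤ v i
        inner : Fin m → Fin n
        inner x = select α β (side G ⊤ v i x)
        c′ : Fin m → Fin n
        c′ x = if does (x ∈? B) then inner x else c x
        cross : ∀ x y → x ∈ B → y ∉ B → x ~ y → inner x ≢ c y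
        cross x y x∈B y∉B x~y eq =
          avoids x y x∈B y∉B x~y (trans (sym eq) (cong (select α β) (side-boundary G ⊤ v i x∈B ∈⊤ x~y y∉B)))
        proper′ : ∀ x y → x ~ y → c′ x ≢ c′ y
        proper′ x y x~y eq with x ∈? B | y ∈? B
        ... | yes x∈B | yes y∈B =
          side-proper G ⊤ v noOdd ∈⊤ i i+1+i≤L x∈B y∈B x~y (select-injective α≢β _ _ eq)
        ... | yes x∈B | no y∉B  = cross x y x∈B y∉B x~y eq
        ... | no x∉B  | yes y∈B = cross y x y∈B x∉B (~-sym x~y) (sym eq)
        ... | no x∉B  | no y∉B  = proper x y (x∉p⇒x∈∁p x∉B) (x∉p⇒x∈∁p y∉B) x~y eq

      colorable-by-large-ball : ∀ v i → i + suc i ≤ L →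
        ColorableOn (suc n) (∁ (ball G ⊤ v i)) → Colorable (suc (suc n)) G
      colorable-by-large-ball v i i+1+i≤L colorable with c , proper ← total colorable =
        extend-over-ball v i i+1+i≤L (suc ∘ c)
          (λ x y x∉ y∉ x~y eq → proper x y x∉ y∉ x~y (Fin.suc-injective eq))
          -- The new colour `zero` goes on the last sphere; `suc zero` is one of the old colours.
          zero (suc zero) (λ ()) (λ _ _ _ _ _ ())

      -- A sphere with fewer than n vertices misses one of the n colours, which is then free for the
      -- next sphere inwards.
      colorable-by-small-sphere : ∀ v i → i + suc i ≤ L →
        ∣ ball G ⊤ v (suc i) ∣ < ∣ ball G ⊤ v i ∣ + suc (suc n) →
        ColorableOn (suc (suc n)) (∁ (ball G ⊤ v i)) → Colorable (suc (suc n)) G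
      colorable-by-small-sphere {n} v i i+1+i≤L small colorable = finish (Fin.all? used?)
        where
        B S : Subset m
        B = ball G ⊤ v i
        S = ball G ⊤ v (suc i) ─ B
        c = proj₁ (total colorable)
        proper = proj₂ (total colorable)
        Used : Fin (suc (suc n)) → Set
        Used α = ∃[ y ] y ∈ S × c y ≡ α
        used? : Decidable Used
        used? α = Fin.any? λ y → (y ∈? S) ×-dec (c y Fin.≟ α)
        ∣S∣<n : ∣ S ∣ < suc (suc n)
        ∣S∣<n = +-cancelʳ-< ∣ B ∣ ∣ S ∣ (suc (suc n)) (begin-strict
          ∣ S ∣ + ∣ B ∣                ≡⟨ ∣p─q∣+∣q∣≡∣p∣ _ B (ball⊆ball-suc G ⊤ v i) ⟩
          ∣ ball G ⊤ v (suc i) ∣       <⟨ small ⟩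
          ∣ B ∣ + suc (suc n)          ≡⟨ +-comm ∣ B ∣ _ ⟩
          suc (suc n) + ∣ B ∣          ∎)
          where open ≤-Reasoning
        other : ∀ α → ∃[ β ] α ≢ β
        other zero    = suc zero , λ ()
        other (suc _) = zero , λ ()
        finish : Dec (∀ α → Used α) → Colorable (suc (suc n)) G
        -- If every colour occurred on `S`, choosing a vertex for each would inject the colours into
        -- `S`.
        finish (yes all) = contradiction (Fin.injective⇒≤ {f = f} f-injective) (<⇒≱ ∣S∣<n)
          where
          f : Fin (suc (suc n)) → Fin ∣ S ∣
          f α = index (proj₁ (proj₂ (all α)))
          f-injective : Injective _≡_ _≡_ f
          f-injective {α} {β} eq = begin
            α                  ≡⟨ proj₂ (proj₂ (all α)) ⟨
            c (proj₁ (all α))  ≡⟨ cong c (element-index (proj₁ (proj₂ (all α)))) ⟨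
            c (element S (f α)) ≡⟨ cong (c ∘ element S) eq ⟩
            c (element S (f β)) ≡⟨ cong c (element-index (proj₁ (proj₂ (all β)))) ⟩
            c (proj₁ (all β))  ≡⟨ proj₂ (proj₂ (all β)) ⟩
            β                  ∎
            where open ≡-Reasoning
        finish (no ¬all) with α , unused ← Fin.¬∀⟶∃¬ _ Used used? ¬all =
          extend-over-ball v i i+1+i≤L c proper α (proj₁ (other α)) (proj₂ (other α))
            λ x y x∈B y∉B x~y cy≡α →
              unused (y , x∈p∧x∉q⇒x∈p─q (neighbour∈ball-suc G ⊤ v i x∈B ∈⊤ x~y) y∉B , cy≡α)

      -- Balls that grow by a factor less than N / D in their last step are cut off one after another;
      -- their last spheres separate the interiors from each other.
      grow : ∀ h → h + h ≤ L → ∀ N D → (∀ v → ∣ ball G ⊤ v h ∣ * D ^ h < N ^ h) →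
        ∀ R → Acc _<_ ∣ R ∣ → Growth N D R
      grow h h+h≤L N D bounded R (acc rec) with nonempty? R
      ... | no  R∅ = record
        { interior = ⊥ ; interior⊆ = λ x∈ → contradiction x∈ ∉⊥ ; color = λ _ → 0ℙ
        ; proper = λ _ _ x∈ → contradiction x∈ ∉⊥
        ; dense = subst (λ z → z * D ≤ N * ∣ ⊥ {m} ∣) (sym (trans (cong ∣_∣ (Empty-unique R∅)) (∣⊥∣≡0 m))) z≤n
        ; dense-strict = λ R≢∅ → contradiction R≢∅ R∅ }
      ... | yes (v , v∈R)
        with i , i<h , slow ← slow-step (λ i → ∣ ball G R v i ∣) N D h (∣⁅x⁆∣≡1 v)
               (≤-<-trans (*-monoˡ-≤ (D ^ h) (p⊆q⇒∣p∣≤∣q∣ (ball-mono R v h))) (bounded v)) = record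
        { interior = I ; interior⊆ = I⊆R ; color = col ; proper = prop
        ; dense = <⇒≤ strict ; dense-strict = λ _ → strict }
        where
        B B⁺ R′ I : Subset m
        B  = ball G R v i
        B⁺ = ball G R v (suc i)
        R′ = R ─ B⁺
        B⁺⊆R : B⁺ ⊆ R
        B⁺⊆R = ball⊆ G R v v∈R (suc i)
        -- `B⁺` contains `v`, so the remainder is smaller. Removing `B⁺` but keeping only `B` leaves
        -- the last sphere as separator.
        module Rest = Growth (grow h h+h≤L N D bounded R′ (rec (p∩q≢∅⇒∣p─q∣<∣p∣ R B⁺
          (v , x∈p∩q⁺ (v∈R , center∈ball G R v (suc i))))))
        I = B ∪ Rest.interior
        rest∉B⁺ : ∀ {x} → x ∈ Rest.interior → x ∉ B⁺
        rest∉B⁺ x∈ = x∈p─q⇒x∉q R B⁺ (Rest.interior⊆ x∈)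
        rest∈R : ∀ {x} → x ∈ Rest.interior → x ∈ R
        rest∈R x∈ = p─q⊆p R B⁺ (Rest.interior⊆ x∈)
        separated : ∀ {x y} → x ∈ B → y ∈ Rest.interior → ¬ x ~ y
        separated x∈B y∈ x~y = rest∉B⁺ y∈ (neighbour∈ball-suc G R v i x∈B (rest∈R y∈) x~y)
        I⊆R : I ⊆ R
        I⊆R x∈ with x∈p∪q⁻ B _ x∈
        ... | inj₁ x∈B = B⁺⊆R (ball⊆ball-suc G R v i x∈B)
        ... | inj₂ x∈I = rest∈R x∈I
        col : Fin m → Parity
        col x = if does (x ∈? B) then side G R v i x else Rest.color x
        i+1+i≤L : i + suc i ≤ L
        i+1+i≤L = ≤-trans (+-mono-≤ (<⇒≤ i<h) i<h) h+h≤L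
        ∈rest : ∀ {x} → x ∈ I → x ∉ B → x ∈ Rest.interior
        ∈rest x∈I x∉B with x∈p∪q⁻ B _ x∈I
        ... | inj₁ x∈B = contradiction x∈B x∉B
        ... | inj₂ x∈  = x∈
        prop : ∀ x y → x ∈ I → y ∈ I → x ~ y → col x ≢ col y
        prop x y x∈ y∈ x~y eq with x ∈? B | y ∈? B
        ... | yes x∈B | yes y∈B = side-proper G R v noOdd v∈R i i+1+i≤L x∈B y∈B x~y eq
        ... | yes x∈B | no y∉B  = separated x∈B (∈rest y∈ y∉B) x~y
        ... | no x∉B  | yes y∈B = separated y∈B (∈rest x∈ x∉B) (~-sym x~y)
        ... | no x∉B  | no y∉B  = Rest.proper x y (∈rest x∈ x∉B) (∈rest y∈ y∉B) x~y eq
        strict : ∣ R ∣ * D < N * ∣ I ∣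
        strict = begin-strict
          ∣ R ∣ * D                            ≡⟨ cong (_* D) (∣p─q∣+∣q∣≡∣p∣ R B⁺ B⁺⊆R) ⟨
          (∣ R′ ∣ + ∣ B⁺ ∣) * D                ≡⟨ *-distribʳ-+ D ∣ R′ ∣ ∣ B⁺ ∣ ⟩
          ∣ R′ ∣ * D + ∣ B⁺ ∣ * D              <⟨ +-mono-≤-< Rest.dense slow ⟩
          N * ∣ Rest.interior ∣ + N * ∣ B ∣    ≡⟨ *-distribˡ-+ N ∣ Rest.interior ∣ ∣ B ∣ ⟨
          N * (∣ Rest.interior ∣ + ∣ B ∣)      ≡⟨ cong (N *_) (+-comm ∣ Rest.interior ∣ ∣ B ∣) ⟩
          N * (∣ B ∣ + ∣ Rest.interior ∣)
            ≡⟨ cong (N *_) (∣p∪q∣≡∣p∣+∣q∣ B _ (λ x∈B x∈I → rest∉B⁺ x∈I (ball⊆ball-suc G R v i x∈B))) ⟨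
          N * ∣ I ∣                            ∎
          where open ≤-Reasoning

      -- The growth factor is `m / D` with `m` the number of vertices, so the strict density of the
      -- interior says just that it has more than `D` vertices. It takes two colours and its
      -- complement takes `n` others.
      colorable-by-growth : ∀ h → h + h ≤ L → ∀ D → (∀ v → ∣ ball G ⊤ v h ∣ * D ^ h < m ^ h) → Fin m →
        (∀ p → ∣ p ∣ < m ∸ D → ColorableOn n p) → Colorable (2 + n) G
      colorable-by-growth {n} h h+h≤L D bounded v₀ colorable = c′ , proper′
        where
        open Growth (grow h h+h≤L m D bounded ⊤ (<-wellFounded _))
        D<∣I∣ : D < ∣ interior ∣
        D<∣I∣ = *-cancelˡ-< m D ∣ interior ∣ (subst (λ z → z * D < m * ∣ interior ∣) (∣⊤∣≡n m) (dense-strict (v₀ , ∈⊤)))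
        outer : ColorableOn n (∁ interior)
        outer = colorable (∁ interior) (subst (_< m ∸ D) (sym (∣∁p∣≡n∸∣p∣ interior))
          (∸-monoʳ-< D<∣I∣ (∣p∣≤n interior)))
        c = proj₁ outer
        c′ : Fin m → Fin (2 + n)
        c′ x with x ∈? interior
        ... | yes _   = select zero (suc zero) (color x)
        ... | no  x∉I = 2 ↑ʳ c x (x∉p⇒x∈∁p x∉I)
        cross : ∀ p (j : Fin n) → select {Fin (2 + n)} zero (suc zero) p ≢ 2 ↑ʳ j
        cross 0ℙ j ()
        cross 1ℙ j ()
        proper′ : ∀ x y → x ~ y → c′ x ≢ c′ y
        proper′ x y x~y eq with x ∈? interior | y ∈? interior
        ... | yes x∈ | yes y∈ = proper x y x∈ y∈ x~y (select-injective (λ ()) _ _ eq)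
        ... | yes x∈ | no y∉  = cross (color x) _ eq
        ... | no x∉  | yes y∈ = cross (color y) _ (sym eq)
        ... | no x∉  | no y∉  = proj₂ outer x y _ _ x~y (Fin.↑ʳ-injective 2 _ _ eq)

  -- The two inequalities that the maximality of f(n,k) yields

  module _ (n p : ℕ) {f₀ f₁ : ℕ} where
    private
      h k : ℕ
      h = suc p
      k = suc h

      forces-suc : ForcesColorable (2 + n) k f₀ →
        (∀ (G : Graph (suc f₀)) → NoOddCycle≤ (2 * k ∸ 1) G → Colorable (2 + n) G) →
        ForcesColorable (2 + n) k (suc f₀)
      forces-suc forces₀ colorable {m} G noOdd m≤1+f₀ with m≤n⇒m<n∨m≡n m≤1+f₀
      ... | inj₁ m<1+f₀ = forces₀ G noOdd (s≤s⁻¹ m<1+f₀)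
      ... | inj₂ refl   = colorable G noOdd

      h+h≤2k-1 : h + h ≤ 2 * k ∸ 1
      h+h≤2k-1 = +-monoʳ-≤ h (≤-trans (n≤1+n h) (m≤m+n k 0))

      i+1+i≤2k-1 : ∀ {i} → i ≤ h → i + suc i ≤ 2 * k ∸ 1
      i+1+i≤2k-1 i≤h = +-mono-≤ i≤h (≤-trans (s≤s i≤h) (m≤m+n k 0))

      colorable-by-ball : ForcesColorable (1 + n) k f₁ → (G : Graph (suc f₀)) → NoOddCycle≤ (2 * k ∸ 1) G →
        ∀ v → f₀ < f₁ + ∣ ball G ⊤ v h ∣ → Colorable (2 + n) G
      colorable-by-ball forces₁ G noOdd v large = colorable-by-large-ball G noOdd v h (i+1+i≤2k-1 ≤-refl)
        (colorableOn G {k = k} forces₁ noOdd _ (subst (_≤ f₁) (sym (∣∁p∣≡n∸∣p∣ (ball G ⊤ v h)))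
          (m≤n+o⇒m∸n≤o (suc f₀) ∣ ball G ⊤ v h ∣ (subst (suc f₀ ≤_) (+-comm f₁ _) large))))

    -- Makes t = f₀ - f₁ admissible in the minimum. If it failed, a single ball would colour any
    -- graph on f₀ + 1 vertices: it would be large or have a small sphere.
    f₁+n[k-1]+1≤f₀ : f[ 2 + n , k ]≡ f₀ → ForcesColorable (1 + n) k f₁ → f₁ + ((2 + n) * h + 1) ≤ f₀
    f₁+n[k-1]+1≤f₀ (forces₀ , maximal) forces₁ with f₁ + ((2 + n) * h + 1) ≤? f₀
    ... | yes ≤f₀ = ≤f₀
    ... | no  ≰f₀ = contradiction (maximal (suc f₀) (forces-suc forces₀ colorable)) 1+n≰n
      where
      colorable : (G : Graph (suc f₀)) → NoOddCycle≤ (2 * k ∸ 1) G → Colorable (2 + n) G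
      colorable G noOdd with f₀ <? f₁ + ∣ ball G ⊤ zero h ∣
      ... | yes large = colorable-by-ball forces₁ G noOdd zero large
      ... | no  small
        with i , i<h , step ← small-step (λ i → ∣ ball G ⊤ zero i ∣) (2 + n) h (∣⁅x⁆∣≡1 {suc f₀} zero)
               (+-cancelˡ-< f₁ _ _ (≤-<-trans (≮⇒≥ small) (≰⇒> ≰f₀))) =
        -- The ball contains its centre, so at most `f₀` vertices lie outside and `forces₀` itself
        -- colours them.
        colorable-by-small-sphere G noOdd zero i (i+1+i≤2k-1 (<⇒≤ i<h)) step
          (colorableOn G {k = k} forces₀ noOdd _ (subst (_≤ f₀) (sym (∣∁p∣≡n∸∣p∣ (ball G ⊤ zero i)))
            (∸-monoʳ-≤ (suc f₀) (subst (_≤ ∣ ball G ⊤ zero i ∣) (∣⁅x⁆∣≡1 {suc f₀} zero)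
              (p⊆q⇒∣p∣≤∣q∣ (λ x∈ → subst (_∈ ball G ⊤ zero i) (sym (x∈⁅y⁆⇒x≡y zero x∈)) (center∈ball G ⊤ zero i)))))))

    -- With t = f₀ - f₁ and r = t^(1/h) this reads f₀ + 1 ≤ r (f₀ - f₂), which is the second term
    -- being at most f₀. If it failed, balls of at most t vertices would meet the bound of
    -- `colorable-by-growth` for D = f₀ - f₂.
    [1+f₀]^[k-1]≤ : ∀ {f₂} → f[ 2 + n , k ]≡ f₀ → ForcesColorable (1 + n) k f₁ → ForcesColorable n k f₂ →
      suc f₀ ^ h ≤ (f₀ ∸ f₁) * (f₀ ∸ f₂) ^ h
    [1+f₀]^[k-1]≤ {f₂} (forces₀ , maximal) forces₁ forces₂ with suc f₀ ^ h ≤? (f₀ ∸ f₁) * (f₀ ∸ f₂) ^ h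
    ... | yes ≤t = ≤t
    ... | no  ≰t = contradiction (maximal (suc f₀) (forces-suc forces₀ colorable)) 1+n≰n
      where
      -- f₀ ≤ f₂ + (f₀ ∸ f₂) holds even if the subtraction truncates, so no comparison of `f₂` with
      -- `f₀` enters.
      <⇒≤f₂ : ∀ {s} → s < suc f₀ ∸ (f₀ ∸ f₂) → s ≤ f₂
      <⇒≤f₂ {s} s< = s≤s⁻¹ (≤-trans s< (m≤n+o⇒m∸n≤o (suc f₀) (f₀ ∸ f₂)
        (subst (suc f₀ ≤_) (trans (cong suc (+-comm f₂ (f₀ ∸ f₂))) (sym (+-suc (f₀ ∸ f₂) f₂))) (s≤s (m≤n+m∸n f₀ f₂)))))
      colorable : (G : Graph (suc f₀)) → NoOddCycle≤ (2 * k ∸ 1) G → Colorable (2 + n) G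
      colorable G noOdd with Fin.any? (λ v → f₀ <? f₁ + ∣ ball G ⊤ v h ∣)
      ... | yes (v , large) = colorable-by-ball forces₁ G noOdd v large
      ... | no  none = colorable-by-growth G noOdd h h+h≤2k-1 (f₀ ∸ f₂) bounded zero
        (λ s ∣s∣< → colorableOn G {k = k} forces₂ noOdd s (<⇒≤f₂ ∣s∣<))
        where
        bounded : ∀ v → ∣ ball G ⊤ v h ∣ * (f₀ ∸ f₂) ^ h < suc f₀ ^ h
        bounded v = ≤-<-trans (*-monoˡ-≤ ((f₀ ∸ f₂) ^ h)
          (m+n≤o⇒m≤o∸n ∣ ball G ⊤ v h ∣ (subst (_≤ f₀) (+-comm f₁ _) (≮⇒≥ (λ large → none (v , large)))))) (≰⇒> ≰t)

module Estimates where

  open import Data.Nat as ℕ using (ℕ; zero; suc; z≤n; s≤s)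
  import Data.Nat.Properties as ℕ
  import Data.Nat.Solver as ℕ-Solver
  open import Data.Integer as ℤ using (+_)
  import Data.Integer.Properties as ℤ
  open import Data.Rational as ℚ using (ℚ; 0ℚ; 1ℚ; ½; _+_; _*_; _-_; -_; _≤_; _<_; _/_)
  import Data.Rational.Properties as ℚ
  open import Data.Rational.Solver using (module +-*-Solver)
  import Data.Rational.Unnormalised as ℚᵘ
  import Data.Rational.Unnormalised.Properties as ℚᵘ
  open import Defs
  open +-*-Solver using (solve; _:=_; con) renaming (_:+_ to _⊕_; _:*_ to _⊗_; :-_ to ⊝_)

  -- Fractions and the order of the reals

  /-* : ∀ a b c → (+ a / suc b) * (+ c / 1) ≡ + (a ℕ.* c) / suc b
  /-* a b c = ℚ.toℚᵘ-injective (begin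
    ℚ.toℚᵘ ((+ a / suc b) * (+ c / 1))
      ≈⟨ ℚ.toℚᵘ-homo-* (+ a / suc b) (+ c / 1) ⟩
    ℚ.toℚᵘ (+ a / suc b) ℚᵘ.* ℚ.toℚᵘ (+ c / 1)
      ≈⟨ ℚᵘ.*-cong (ℚ.toℚᵘ-fromℚᵘ (ℚᵘ.mkℚᵘ (+ a) b)) (ℚ.toℚᵘ-fromℚᵘ (ℚᵘ.mkℚᵘ (+ c) 0)) ⟩
    ℚᵘ.mkℚᵘ (+ a) b ℚᵘ.* ℚᵘ.mkℚᵘ (+ c) 0
      ≈⟨ ℚᵘ.*≡* (cong₂ ℤ._*_ (sym (ℤ.pos-* a c)) (cong +_ (sym (ℕ.*-identityʳ (suc b))))) ⟩
    ℚᵘ.mkℚᵘ (+ (a ℕ.* c)) b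
      ≈⟨ ℚ.toℚᵘ-fromℚᵘ (ℚᵘ.mkℚᵘ (+ (a ℕ.* c)) b) ⟨
    ℚ.toℚᵘ (+ (a ℕ.* c) / suc b) ∎)
    where open ℚᵘ.≃-Reasoning

  /1-mono-≤ : ∀ {a b} → a ℕ.≤ b → + a / 1 ≤ + b / 1
  /1-mono-≤ {a} {b} a≤b = /-mono-≤ {a} {0} {b} {0} (ℕ.*-monoˡ-≤ 1 a≤b)

  eventually-≤⇒≤ᴿ : ∀ {x y} → ∃[ N ] (∀ i → N ℕ.≤ i → seq x i ≤ seq y i) → x ≤ᴿ y
  eventually-≤⇒≤ᴿ {x} {y} (N , x≤y) ε ε>0 = N , λ i N≤i →
    ℚ.≤-trans (x≤y i N≤i) (subst (_≤ seq y i + ε) (ℚ.+-identityʳ (seq y i)) (ℚ.+-monoʳ-≤ (seq y i) (ℚ.<⇒≤ ε>0)))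

  ≤ᴿ-refl : ∀ {x} → x ≤ᴿ x
  ≤ᴿ-refl {x} = eventually-≤⇒≤ᴿ {x} {x} (0 , λ _ _ → ℚ.≤-refl)

  ≤ᴿ-trans : ∀ {x y z} → x ≤ᴿ y → y ≤ᴿ z → x ≤ᴿ z
  ≤ᴿ-trans {x} {y} {z} x≤y y≤z ε ε>0
    with N₁ , h₁ ← x≤y (ε * ½) (ε/2>0 ε>0) | N₂ , h₂ ← y≤z (ε * ½) (ε/2>0 ε>0) =
    N₁ ℕ.⊔ N₂ , λ i N≤i → begin
      seq x i                        ≤⟨ h₁ i (ℕ.m⊔n≤o⇒m≤o N₁ N₂ N≤i) ⟩
      seq y i + ε * ½                ≤⟨ ℚ.+-monoˡ-≤ (ε * ½) (h₂ i (ℕ.m⊔n≤o⇒n≤o N₁ N₂ N≤i)) ⟩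
      seq z i + ε * ½ + ε * ½        ≡⟨ ℚ.+-assoc (seq z i) (ε * ½) (ε * ½) ⟩
      seq z i + (ε * ½ + ε * ½)      ≡⟨ cong (_+_ (seq z i)) (ε/2+ε/2 ε) ⟩
      seq z i + ε                    ∎
    where open ℚ.≤-Reasoning

  ⊔ᴿ-lub : ∀ {x y z} → x ≤ᴿ z → y ≤ᴿ z → x ⊔ᴿ y ≤ᴿ z
  ⊔ᴿ-lub {x} {y} {z} x≤z y≤z ε ε>0 with N₁ , h₁ ← x≤z ε ε>0 | N₂ , h₂ ← y≤z ε ε>0 =
    N₁ ℕ.⊔ N₂ , λ i N≤i → ℚ.⊔-lub {y = seq x i} {z = seq y i}
      (h₁ i (ℕ.m⊔n≤o⇒m≤o N₁ N₂ N≤i)) (h₂ i (ℕ.m⊔n≤o⇒n≤o N₁ N₂ N≤i))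

  x≤ᴿx⊔y : ∀ x y → x ≤ᴿ x ⊔ᴿ y
  x≤ᴿx⊔y x y = eventually-≤⇒≤ᴿ {x} {x ⊔ᴿ y} (0 , λ i _ → ℚ.p≤p⊔q (seq x i) (seq y i))

  y≤ᴿx⊔y : ∀ x y → y ≤ᴿ x ⊔ᴿ y
  y≤ᴿx⊔y x y = eventually-≤⇒≤ᴿ {y} {x ⊔ᴿ y} (0 , λ i _ → ℚ.p≤q⊔p (seq x i) (seq y i))

  fromℕᴿ-mono : ∀ {a b} → a ℕ.≤ b → fromℕᴿ a ≤ᴿ fromℕᴿ b
  fromℕᴿ-mono {a} {b} a≤b = eventually-≤⇒≤ᴿ {fromℕᴿ a} {fromℕᴿ b} (0 , λ _ _ → /1-mono-≤ a≤b)

  -- The term with the root, compared with integers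

  module _ (p : ℕ) where

    -- The index from which root-1≥ keeps the approximations of t^(1/(p+1)) - 1 away from 0.
    j₀ : ℕ
    j₀ = 2 ℕ.* (p ℕ.+ suc p)

    δ : ℚ
    δ = + 1 / suc (2 ℕ.* (p ℕ.+ p) ℕ.+ 1)

    δ>0 : 0ℚ < δ
    δ>0 = ℚ.positive⁻¹ _ {{ℚ.normalize-pos 1 (suc (2 ℕ.* (p ℕ.+ p) ℕ.+ 1))}}

    -- Definitionally the `j`-th term of `root (suc p) t`.
    q : ℕ → ℕ → ℚ
    q t j = + rootNum p t j / suc j

    module _ {t j} (t≥2 : 2 ℕ.≤ t) (j≥j₀ : j₀ ℕ.≤ j) where

      δ≤q-1 : δ ≤ q t j - 1ℚ
      δ≤q-1 = root-1≥ p t j t≥2 (ℕ.m≤n⇒m≤1+n j≥j₀)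

      q-1>0 : 0ℚ < q t j - 1ℚ
      q-1>0 = ℚ.<-≤-trans δ>0 δ≤q-1

      inv[q-1]≤ : inv (q t j - 1ℚ) ≤ inv δ
      inv[q-1]≤ = inv-antimono δ>0 δ≤q-1

      -- The form 1 + 1/(q - 1) shows that q/(q - 1) decreases in q, which gives `bound-antitone`.
      q*inv[q-1] : q t j * inv (q t j - 1ℚ) ≡ 1ℚ + inv (q t j - 1ℚ)
      q*inv[q-1] = trans
        (solve 2 (λ q y → q ⊗ y := y ⊗ (q ⊕ ⊝ con 1ℚ) ⊕ y) refl (q t j) (inv (q t j - 1ℚ)))
        (cong (_+ inv (q t j - 1ℚ)) (inv-inverseˡ q-1>0))

    rootNum-mono : ∀ {s t} j → s ℕ.≤ t → rootNum p s j ℕ.≤ rootNum p t j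
    rootNum-mono {s} {t} j s≤t = ℕ.≤-pred (^-cancel-< (suc p) (begin-strict
      rootNum p s j ℕ.^ suc p          ≤⟨ iroot-lower p (s ℕ.* suc j ℕ.^ suc p) ⟩
      s ℕ.* suc j ℕ.^ suc p            ≤⟨ ℕ.*-monoˡ-≤ (suc j ℕ.^ suc p) s≤t ⟩
      t ℕ.* suc j ℕ.^ suc p            <⟨ iroot-upper p (t ℕ.* suc j ℕ.^ suc p) ⟩
      suc (rootNum p t j) ℕ.^ suc p    ∎))
      where open ℕ.≤-Reasoning

    q-mono : ∀ {s t} j → s ℕ.≤ t → q s j ≤ q t j
    q-mono {s} {t} j s≤t = /-mono-≤ {rootNum p s j} {j} {rootNum p t j} {j} (ℕ.*-monoˡ-≤ (suc j) (rootNum-mono j s≤t))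

    private module N = ℕ-Solver.+-*-Solver

    -- The hypothesis means A ≤ t^(1/(p+1)) D. As `q t j` is rounded down, it has to be raised by
    -- one unit 1/(j+1); in `q-upper` the rounding is favourable.
    q-lower : ∀ t A D j → A ℕ.^ suc p ℕ.≤ t ℕ.* D ℕ.^ suc p → + A / 1 ≤ (q t j + (+ 1 / suc j)) * (+ D / 1)
    q-lower t A D j A^m≤tD^m = begin
      + A / 1                                      ≤⟨ /-mono-≤ {A} {0} {(a ℕ.+ 1) ℕ.* D} {j} A[j+1]≤ ⟩
      + ((a ℕ.+ 1) ℕ.* D) / suc j                  ≡⟨ /-* (a ℕ.+ 1) j D ⟨
      (+ (a ℕ.+ 1) / suc j) * (+ D / 1)            ≡⟨ cong (_* (+ D / 1)) (/-+ a 1 j) ⟨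
      (q t j + (+ 1 / suc j)) * (+ D / 1)          ∎
      where
      open ℚ.≤-Reasoning
      a = rootNum p t j
      W = suc j ℕ.^ suc p
      power : (A ℕ.* suc j) ℕ.^ suc p ℕ.≤ (suc a ℕ.* D) ℕ.^ suc p
      power = ℕR.begin
        (A ℕ.* suc j) ℕ.^ suc p              ℕR.≡⟨ ^-distribʳ-* A (suc j) (suc p) ⟩
        A ℕ.^ suc p ℕ.* W                   ℕR.≤⟨ ℕ.*-monoˡ-≤ W A^m≤tD^m ⟩
        t ℕ.* D ℕ.^ suc p ℕ.* W
          ℕR.≡⟨ N.solve 3 (λ t d j → t N.:* d N.:* j N.:= t N.:* j N.:* d) refl t (D ℕ.^ suc p) W ⟩
        t ℕ.* W ℕ.* D ℕ.^ suc p             ℕR.≤⟨ ℕ.*-monoˡ-≤ (D ℕ.^ suc p) (ℕ.<⇒≤ (iroot-upper p (t ℕ.* W))) ⟩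
        suc a ℕ.^ suc p ℕ.* D ℕ.^ suc p      ℕR.≡⟨ ^-distribʳ-* (suc a) D (suc p) ⟨
        (suc a ℕ.* D) ℕ.^ suc p              ℕR.∎
        where module ℕR = ℕ.≤-Reasoning
      A[j+1]≤ : A ℕ.* suc j ℕ.≤ (a ℕ.+ 1) ℕ.* D ℕ.* 1
      A[j+1]≤ = subst (A ℕ.* suc j ℕ.≤_)
        (trans (cong (ℕ._* D) (ℕ.+-comm 1 a)) (sym (ℕ.*-identityʳ _)))
        (ℕ.≮⇒≥ λ lt → ℕ.<⇒≱ (ℕ.^-monoˡ-< (suc p) lt) power)

    q-upper : ∀ t A D j → t ℕ.* D ℕ.^ suc p ℕ.≤ A ℕ.^ suc p → q t j * (+ D / 1) ≤ + A / 1
    q-upper t A D j tD^m≤A^m = ℚ.≤-trans (ℚ.≤-reflexive (/-* a j D))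
      (/-mono-≤ {a ℕ.* D} {j} {A} {0} (subst (ℕ._≤ A ℕ.* suc j) (sym (ℕ.*-identityʳ (a ℕ.* D)))
        (ℕ.≮⇒≥ λ lt → ℕ.<⇒≱ (ℕ.^-monoˡ-< (suc p) lt) power)))
      where
      open ℕ.≤-Reasoning
      a = rootNum p t j
      W = suc j ℕ.^ suc p
      power : (a ℕ.* D) ℕ.^ suc p ℕ.≤ (A ℕ.* suc j) ℕ.^ suc p
      power = begin
        (a ℕ.* D) ℕ.^ suc p              ≡⟨ ^-distribʳ-* a D (suc p) ⟩
        a ℕ.^ suc p ℕ.* D ℕ.^ suc p      ≤⟨ ℕ.*-monoˡ-≤ (D ℕ.^ suc p) (iroot-lower p (t ℕ.* W)) ⟩
        t ℕ.* W ℕ.* D ℕ.^ suc p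
          ≡⟨ N.solve 3 (λ t j d → t N.:* j N.:* d N.:= t N.:* d N.:* j) refl t W (D ℕ.^ suc p) ⟩
        t ℕ.* D ℕ.^ suc p ℕ.* W         ≤⟨ ℕ.*-monoˡ-≤ W tD^m≤A^m ⟩
        A ℕ.^ suc p ℕ.* W               ≡⟨ ^-distribʳ-* A (suc j) (suc p) ⟨
        (A ℕ.* suc j) ℕ.^ suc p          ∎

    module _ (f₂ : ℕ) where

      c : ℚ
      c = (+ f₂ / 1) + 1ℚ

      c≡1+f₂ : c ≡ + suc f₂ / 1
      c≡1+f₂ = trans (/-+ f₂ 1 0) (cong (λ z → + z / 1) (ℕ.+-comm f₂ 1))

      c≥0 : 0ℚ ≤ c
      c≥0 = subst (0ℚ ≤_) (sym c≡1+f₂) (/1-mono-≤ {0} {suc f₂} z≤n)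

      bound : ∀ t → 0ᴿ <ᴿ root (suc p) t -ᴿ 1ᴿ → ℝ
      bound t pos = let r = root (suc p) t in r ÷ᴿ (r -ᴿ 1ᴿ) ⟨ pos ⟩ *ᴿ (fromℕᴿ f₂ +ᴿ 1ᴿ) -ᴿ 1ᴿ

      -- bound t ≤ M without the root r = t^(1/(p+1)): it amounts to M + 1 ≤ r (M - f₂).
      -- For M ≤ f₂ the truncated difference makes it false, as it should be.
      Below : ℕ → ℕ → Set
      Below t M = suc M ℕ.^ suc p ℕ.≤ t ℕ.* (M ℕ.∸ f₂) ℕ.^ suc p

      below? : ∀ t M → Dec (Below t M)
      below? t M = suc M ℕ.^ suc p ℕ.≤? t ℕ.* (M ℕ.∸ f₂) ℕ.^ suc p

      below⇒f₂<M : ∀ {t M} → Below t M → f₂ ℕ.< M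
      below⇒f₂<M {t} {M} below = ℕ.≰⇒> λ M≤f₂ → ℕ.<⇒≱ (ℕ.m^n>0 (suc M) (suc p))
        (subst (suc M ℕ.^ suc p ℕ.≤_) (trans (cong (λ d → t ℕ.* d ℕ.^ suc p) (ℕ.m≤n⇒m∸n≡0 M≤f₂)) (ℕ.*-zeroʳ t)) below)

      bound-antitone : ∀ {s t} pos pos′ → 2 ℕ.≤ s → s ℕ.≤ t → bound t pos′ ≤ᴿ bound s pos
      bound-antitone {s} {t} pos pos′ s≥2 s≤t = eventually-≤⇒≤ᴿ {bound t pos′} {bound s pos} (j₀ , λ j j≥j₀ →
        ℚ.+-monoˡ-≤ (- 1ℚ) (ℚ.*-monoʳ-≤-nonNeg c {{ℚ.nonNegative c≥0}} (begin
          q t j * inv (q t j - 1ℚ)   ≡⟨ q*inv[q-1] (ℕ.≤-trans s≥2 s≤t) j≥j₀ ⟩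
          1ℚ + inv (q t j - 1ℚ)
            ≤⟨ ℚ.+-monoʳ-≤ 1ℚ (inv-antimono (q-1>0 s≥2 j≥j₀) (ℚ.+-monoˡ-≤ (- 1ℚ) (q-mono j s≤t))) ⟩
          1ℚ + inv (q s j - 1ℚ)      ≡⟨ q*inv[q-1] s≥2 j≥j₀ ⟨
          q s j * inv (q s j - 1ℚ)   ∎)))
        where open ℚ.≤-Reasoning

      [1+M]-1≡M : ∀ M → (+ suc M / 1) - 1ℚ ≡ + M / 1
      [1+M]-1≡M M = trans (cong (_- 1ℚ) (sym (/-+ 1 M 0))) (solve 1 (λ x → (con 1ℚ ⊕ x) ⊕ ⊝ con 1ℚ := x) refl (+ M / 1))

      -- With c = f₂ + 1 and x = q t j, clearing the denominator gives (x - 1) A ≤ x (D + c) - A ≤ x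
      -- c, from A ≤ D + c and x D ≤ A.
      ¬below⇒≤bound : ∀ {t} pos M → 2 ℕ.≤ t → ¬ Below t M → fromℕᴿ M ≤ᴿ bound t pos
      ¬below⇒≤bound {t} pos M t≥2 ¬below = eventually-≤⇒≤ᴿ {fromℕᴿ M} {bound t pos} (j₀ , λ j j≥j₀ →
        subst (_≤ _) ([1+M]-1≡M M) (ℚ.+-monoˡ-≤ (- 1ℚ) (A≤ j j≥j₀)))
        where
        A D : ℚ
        A = + suc M / 1
        D = + (M ℕ.∸ f₂) / 1
        -- Only an inequality, since M ∸ f₂ may truncate.
        A≤D+c : A ≤ D + c
        A≤D+c = ℚ.≤-trans
          (/1-mono-≤ (subst (suc M ℕ.≤_) (sym (ℕ.+-suc (M ℕ.∸ f₂) f₂))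
            (s≤s (subst (M ℕ.≤_) (ℕ.+-comm f₂ _) (ℕ.m≤n+m∸n M f₂)))))
          (ℚ.≤-reflexive (trans (sym (/-+ (M ℕ.∸ f₂) (suc f₂) 0)) (cong (_+_ D) (sym c≡1+f₂))))
        A≤ : ∀ j → j₀ ℕ.≤ j → A ≤ q t j * inv (q t j - 1ℚ) * c
        A≤ j j≥j₀ = begin
          A                              ≡⟨ ℚ.*-identityˡ A ⟨
          1ℚ * A                         ≡⟨ cong (_* A) (inv-inverseˡ x-1>0) ⟨
          y * (x - 1ℚ) * A               ≡⟨ solve 3 (λ y x A → y ⊗ (x ⊕ ⊝ con 1ℚ) ⊗ A := y ⊗ (x ⊗ A ⊕ ⊝ A)) refl y x A ⟩
          y * (x * A - A)
            ≤⟨ ℚ.*-monoˡ-≤-nonNeg y (ℚ.+-monoˡ-≤ (- A) (ℚ.*-monoˡ-≤-nonNeg x A≤D+c)) ⟩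
          y * (x * (D + c) - A)
            ≡⟨ cong (y *_) (solve 4 (λ x D c A → x ⊗ (D ⊕ c) ⊕ ⊝ A := x ⊗ D ⊕ (x ⊗ c ⊕ ⊝ A)) refl x D c A) ⟩
          y * (x * D + (x * c - A))
            ≤⟨ ℚ.*-monoˡ-≤-nonNeg y (ℚ.+-monoˡ-≤ (x * c - A) (q-upper t (suc M) (M ℕ.∸ f₂) j (ℕ.<⇒≤ (ℕ.≰⇒> ¬below)))) ⟩
          y * (A + (x * c - A))          ≡⟨ solve 4 (λ y x c A → y ⊗ (A ⊕ (x ⊗ c ⊕ ⊝ A)) := x ⊗ y ⊗ c) refl y x c A ⟩
          x * y * c                      ∎
          where
          open ℚ.≤-Reasoning
          x = q t j
          y = inv (x - 1ℚ)
          x-1>0 : 0ℚ < x - 1ℚ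
          x-1>0 = q-1>0 t≥2 j≥j₀
          instance
            _ : ℚ.NonNegative y
            _ = ℚ.nonNegative (ℚ.<⇒≤ (inv-pos x-1>0))
            _ : ℚ.NonNegative x
            _ = ℚ.nonNegative (/-mono-≤ {0} {0} {rootNum p t j} {j} z≤n)

      -- Now A = D + c, so x c / (x - 1) = A + (A - x D) / (x - 1). By `q-lower` the last fraction
      -- is at most 1/(j+1) times D / (x - 1), and this vanishes in the limit.
      below⇒bound≤ : ∀ {t} pos M → 2 ℕ.≤ t → Below t M → bound t pos ≤ᴿ fromℕᴿ M
      below⇒bound≤ {t} pos M t≥2 below ε ε>0 = j₀ ℕ.⊔ N , λ j j≥ →
        subst (q t j * inv (q t j - 1ℚ) * c - 1ℚ ≤_)
          (trans (solve 2 (λ A ε → A ⊕ ε ⊕ ⊝ con 1ℚ := A ⊕ ⊝ con 1ℚ ⊕ ε) refl A ε) (cong (_+ ε) ([1+M]-1≡M M)))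
          (ℚ.+-monoˡ-≤ (- 1ℚ) (≤A+ε j (ℕ.m⊔n≤o⇒m≤o j₀ N j≥) (ℕ.m⊔n≤o⇒n≤o j₀ N j≥)))
        where
        A D : ℚ
        A = + suc M / 1
        D = + (M ℕ.∸ f₂) / 1
        -- A bound on D / (x - 1) that does not depend on j; the index `N` makes 1/(j+1) at most ε /
        -- E.
        E = inv δ * D
        D>0 : 0ℚ < D
        D>0 = ℚ.<-≤-trans (ℚ.positive⁻¹ 1ℚ) (/1-mono-≤ (ℕ.m<n⇒0<n∸m (below⇒f₂<M {t} below)))
        E>0 : 0ℚ < E
        E>0 = *>0 (inv-pos δ>0) D>0
        A≡D+c : A ≡ D + c
        A≡D+c = trans
          (cong (λ z → + z / 1) (sym (trans (ℕ.+-suc (M ℕ.∸ f₂) f₂)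
            (cong suc (ℕ.m∸n+n≡m (ℕ.<⇒≤ (below⇒f₂<M {t} below)))))))
          (trans (sym (/-+ (M ℕ.∸ f₂) (suc f₂) 0)) (cong (_+_ D) (sym c≡1+f₂)))
        arch : ∃[ N ] (∀ j → N ℕ.≤ j → + 1 / suc j ≤ ε * inv E)
        arch = archimedean (ε * inv E) (*>0 ε>0 (inv-pos E>0))
        N = proj₁ arch
        ≤A+ε : ∀ j → j₀ ℕ.≤ j → N ℕ.≤ j → q t j * inv (q t j - 1ℚ) * c ≤ A + ε
        ≤A+ε j j≥j₀ j≥N = begin
          x * y * c
            ≡⟨ solve 4 (λ x y c D → x ⊗ y ⊗ c := y ⊗ (x ⊗ (D ⊕ c) ⊕ ⊝ (x ⊗ D))) refl x y c D ⟩
          y * (x * (D + c) - x * D)    ≡⟨ cong (λ z → y * (x * z - x * D)) A≡D+c ⟨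
          y * (x * A - x * D)
            ≡⟨ solve 4 (λ y x A D → y ⊗ (x ⊗ A ⊕ ⊝ (x ⊗ D)) :=
                 y ⊗ (x ⊕ ⊝ con 1ℚ) ⊗ A ⊕ y ⊗ (A ⊕ ⊝ (x ⊗ D))) refl y x A D ⟩
          y * (x - 1ℚ) * A + y * (A - x * D)
            ≡⟨ cong (_+ y * (A - x * D)) (trans (cong (_* A) (inv-inverseˡ (q-1>0 t≥2 j≥j₀))) (ℚ.*-identityˡ A)) ⟩
          A + y * (A - x * D)
            ≤⟨ ℚ.+-monoʳ-≤ A (ℚ.*-monoˡ-≤-nonNeg y (ℚ.+-monoˡ-≤ (- (x * D)) (q-lower t (suc M) (M ℕ.∸ f₂) j below))) ⟩
          A + y * ((x + η) * D - x * D)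
            ≡⟨ cong (_+_ A) (solve 4 (λ y x η D → y ⊗ ((x ⊕ η) ⊗ D ⊕ ⊝ (x ⊗ D)) := η ⊗ (y ⊗ D)) refl y x η D) ⟩
          A + η * (y * D)
            ≤⟨ ℚ.+-monoʳ-≤ A (*-mono-≤ yD≥0 (ℚ.<⇒≤ (*>0 ε>0 (inv-pos E>0))) (proj₂ arch j j≥N)
                 (ℚ.*-monoʳ-≤-nonNeg D (inv[q-1]≤ t≥2 j≥j₀))) ⟩
          A + ε * inv E * E
            ≡⟨ cong (_+_ A) (trans (ℚ.*-assoc ε (inv E) E) (trans (cong (ε *_) (inv-inverseˡ E>0)) (ℚ.*-identityʳ ε))) ⟩
          A + ε                        ∎
          where
          open ℚ.≤-Reasoning
          x = q t j
          y = inv (x - 1ℚ)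
          η = + 1 / suc j
          y>0 : 0ℚ < y
          y>0 = inv-pos (q-1>0 t≥2 j≥j₀)
          yD≥0 : 0ℚ ≤ y * D
          yD≥0 = ℚ.<⇒≤ (*>0 y>0 D>0)
          instance
            _ : ℚ.NonNegative y
            _ = ℚ.nonNegative (ℚ.<⇒≤ y>0)
            _ : ℚ.NonNegative D
            _ = ℚ.nonNegative (ℚ.<⇒≤ D>0)

  -- Existence of the minimum over t

  first-or-crossing : ∀ {Q : ℕ → Set} → Decidable Q → ∀ {l u} → l ℕ.≤ u → Q u →
    Q l ⊎ (∃[ s ] l ℕ.≤ s × ¬ Q s × Q (suc s))
  first-or-crossing Q? {l} {zero} z≤n Qu = inj₁ Qu
  first-or-crossing Q? {l} {suc u} l≤1+u Q1+u with ℕ.m≤n⇒m<n∨m≡n l≤1+u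
  ... | inj₂ refl = inj₁ Q1+u
  ... | inj₁ (s≤s l≤u) with Q? u
  ...   | yes Qu = first-or-crossing Q? l≤u Qu
  -- The descent has kept `Q (suc u)`, so the first failure met is a crossing.
  ...   | no ¬Qu = inj₂ (u , l≤u , ¬Qu , Q1+u)

  -- An increasing and a decreasing function cross, and the minimum of their maximum is attained next to the crossing.
  minimum-exists : ∀ {l u a} (X : ∀ t → l ℕ.≤ t → ℝ) (Below : ℕ → ℕ → Set) → (∀ t M → Dec (Below t M)) →
    (∀ {t M} t≥l → Below t M → X t t≥l ≤ᴿ fromℕᴿ M) →
    (∀ {t M} t≥l → ¬ Below t M → fromℕᴿ M ≤ᴿ X t t≥l) →
    (∀ {s t} s≥l t≥l → s ℕ.≤ t → X t t≥l ≤ᴿ X s s≥l) →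
    l ℕ.≤ u → Below u (a ℕ.+ u) →
    ∃[ μ ] IsMinimum {l ℕ.≤_} (λ t t≥l → fromℕᴿ (a ℕ.+ t) ⊔ᴿ X t t≥l) μ
  minimum-exists {l} {u} {a} X Below below? X≤ ≤X antitone l≤u below-u =
    from (first-or-crossing (λ t → below? t (a ℕ.+ t)) l≤u below-u)
    where
    g : ∀ t → l ℕ.≤ t → ℝ
    g t t≥l = fromℕᴿ (a ℕ.+ t) ⊔ᴿ X t t≥l

    trans-≤ : ∀ x y z → x ≤ᴿ y → y ≤ᴿ z → x ≤ᴿ z
    trans-≤ x y z = ≤ᴿ-trans {x} {y} {z}

    at : ∀ s s≥l → (∀ t t≥l → g s s≥l ≤ᴿ g t t≥l) → ∃[ μ ] IsMinimum {l ℕ.≤_} g μ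
    at s s≥l min = g s s≥l , (s , s≥l , ≤ᴿ-refl {g s s≥l} , ≤ᴿ-refl {g s s≥l}) , min

    g≤ : ∀ s s≥l z → fromℕᴿ (a ℕ.+ s) ≤ᴿ z → X s s≥l ≤ᴿ z → g s s≥l ≤ᴿ z
    g≤ s s≥l z = ⊔ᴿ-lub {fromℕᴿ (a ℕ.+ s)} {X s s≥l} {z}

    -- Lower bounds for `g t` come from the increasing term for large t and, by `via-X`, from the
    -- decreasing term for small t.
    via-a+t : ∀ {x M} t t≥l → x ≤ᴿ fromℕᴿ M → M ℕ.≤ a ℕ.+ t → x ≤ᴿ g t t≥l
    via-a+t {x} {M} t t≥l x≤M M≤ = trans-≤ x (fromℕᴿ M) (g t t≥l) x≤M
      (trans-≤ (fromℕᴿ M) (fromℕᴿ (a ℕ.+ t)) (g t t≥l) (fromℕᴿ-mono M≤) (x≤ᴿx⊔y (fromℕᴿ (a ℕ.+ t)) (X t t≥l)))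

    via-X : ∀ {x s} s≥l t t≥l → x ≤ᴿ X s s≥l → t ℕ.≤ s → x ≤ᴿ g t t≥l
    via-X {x} {s} s≥l t t≥l x≤X t≤s = trans-≤ x (X s s≥l) (g t t≥l) x≤X
      (trans-≤ (X s s≥l) (X t t≥l) (g t t≥l) (antitone t≥l s≥l t≤s) (y≤ᴿx⊔y (fromℕᴿ (a ℕ.+ t)) (X t t≥l)))

    from : Below l (a ℕ.+ l) ⊎ (∃[ s ] l ℕ.≤ s × ¬ Below s (a ℕ.+ s) × Below (suc s) (a ℕ.+ suc s)) →
      ∃[ μ ] IsMinimum {l ℕ.≤_} g μ
    from (inj₁ below-l) = at l ℕ.≤-refl λ t t≥l →
      via-a+t {g l ℕ.≤-refl} t t≥l
        (g≤ l ℕ.≤-refl (fromℕᴿ (a ℕ.+ l)) (≤ᴿ-refl {fromℕᴿ (a ℕ.+ l)}) (X≤ ℕ.≤-refl below-l)) (ℕ.+-monoʳ-≤ a t≥l)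
    -- Here `g s` is `X s` and `g (suc s)` is a + s + 1. Which of them is smaller depends on
    -- comparing `X s` with an integer, and `below?` decides that.
    from (inj₂ (s , s≥l , ¬below-s , below-1+s)) with below? s (a ℕ.+ suc s)
    ... | yes below = at s s≥l min
      where
      min : ∀ t t≥l → g s s≥l ≤ᴿ g t t≥l
      min t t≥l with t ℕ.≤? s
      ... | yes t≤s = via-X {g s s≥l} s≥l t t≥l (g≤ s s≥l (X s s≥l) (≤X s≥l ¬below-s) (≤ᴿ-refl {X s s≥l})) t≤s
      ... | no  t≰s = via-a+t {g s s≥l} t t≥l
            (g≤ s s≥l (fromℕᴿ (a ℕ.+ suc s)) (fromℕᴿ-mono (ℕ.+-monoʳ-≤ a (ℕ.n≤1+n s))) (X≤ s≥l below))
            (ℕ.+-monoʳ-≤ a (ℕ.≰⇒> t≰s))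
    ... | no ¬below = at (suc s) 1+s≥l min
      where
      1+s≥l = ℕ.m≤n⇒m≤1+n s≥l
      g≤a+1+s : g (suc s) 1+s≥l ≤ᴿ fromℕᴿ (a ℕ.+ suc s)
      g≤a+1+s = g≤ (suc s) 1+s≥l (fromℕᴿ (a ℕ.+ suc s)) (≤ᴿ-refl {fromℕᴿ (a ℕ.+ suc s)}) (X≤ 1+s≥l below-1+s)
      min : ∀ t t≥l → g (suc s) 1+s≥l ≤ᴿ g t t≥l
      min t t≥l with t ℕ.≤? s
      ... | yes t≤s = via-X {g (suc s) 1+s≥l} s≥l t t≥l
            (trans-≤ (g (suc s) 1+s≥l) (fromℕᴿ (a ℕ.+ suc s)) (X s s≥l) g≤a+1+s (≤X s≥l ¬below)) t≤s
      ... | no  t≰s = via-a+t {g (suc s) 1+s≥l} t t≥l g≤a+1+s (ℕ.+-monoʳ-≤ a (ℕ.≰⇒> t≰s))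

-- Combination of the estimates at t = f₀ - f₁

open import Data.Nat using (ℕ; suc; _+_; _*_; _∸_; _≤_; z≤n; s≤s)
open import Data.Nat.Properties using (∸-monoˡ-≤; m+[n∸m]≡n; m+n≤o⇒m≤o; m+n≤o⇒m≤o∸n; +-comm; ≤-reflexive)
open import Defs
open Coloring using (f₁+n[k-1]+1≤f₀; [1+f₀]^[k-1]≤)
open Estimates

theorem1 : ∀ (n k : ℕ) (n≥2 : 2 ≤ n) (k≥2 : 2 ≤ k) →
    ∀ (f₀ f₁ f₂ : ℕ) → f[ n , k ]≡ f₀ → f[ n ∸ 1 , k ]≡ f₁ → f[ n ∸ 2 , k ]≡ f₂ →
    ∃[ μ ] IsMinimum {λ t → n * (k ∸ 1) + 1 ≤ t}
      (λ t t≥ → let r = root (k ∸ 1) t in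
        fromℕᴿ (f₁ + t) ⊔ᴿ
        (r ÷ᴿ (r -ᴿ 1ᴿ) ⟨ root-1>0 (∸-monoˡ-≤ 1 k≥2) (n[k-1]+1≥2 n≥2 k≥2 t≥) ⟩ *ᴿ (fromℕᴿ f₂ +ᴿ 1ᴿ) -ᴿ 1ᴿ))
      μ
    × μ ≤ᴿ fromℕᴿ f₀
theorem1 (suc (suc n)) (suc (suc p)) n≥2@(s≤s (s≤s z≤n)) k≥2@(s≤s (s≤s z≤n))
  f₀ f₁ f₂ f₀-max (forces₁ , _) (forces₂ , _) =
  μ , min , ≤ᴿ-trans {μ} {fromℕᴿ (f₁ + u) ⊔ᴿ X u u≥t₀} {fromℕᴿ f₀} (proj₂ min u u≥t₀)
    (⊔ᴿ-lub {fromℕᴿ (f₁ + u)} {X u u≥t₀} {fromℕᴿ f₀} (fromℕᴿ-mono (≤-reflexive f₁+u≡f₀))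
      (below⇒bound≤ p f₂ (pos u≥t₀) f₀ (t≥2 u≥t₀) below-f₀))
  where
  t₀ u : ℕ
  t₀ = suc (suc n) * suc p + 1
  -- At this t the first term equals f₀ and the second is at most f₀, so the minimum is at most f₀.
  u  = f₀ ∸ f₁

  f₁+t₀≤f₀ : f₁ + t₀ ≤ f₀
  f₁+t₀≤f₀ = f₁+n[k-1]+1≤f₀ n p f₀-max forces₁

  u≥t₀ : t₀ ≤ u
  u≥t₀ = m+n≤o⇒m≤o∸n t₀ (subst (_≤ f₀) (+-comm f₁ t₀) f₁+t₀≤f₀)

  f₁+u≡f₀ : f₁ + u ≡ f₀
  f₁+u≡f₀ = m+[n∸m]≡n (m+n≤o⇒m≤o f₁ {t₀} f₁+t₀≤f₀)

  below-f₀ : Below p f₂ u f₀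
  below-f₀ = [1+f₀]^[k-1]≤ n p f₀-max forces₁ forces₂

  t≥2 : ∀ {t} → t₀ ≤ t → 2 ≤ t
  t≥2 = n[k-1]+1≥2 n≥2 k≥2

  pos : ∀ {t} → t₀ ≤ t → 0ᴿ <ᴿ root (suc p) t -ᴿ 1ᴿ
  pos {t} t≥t₀ = root-1>0 {suc p} {t} (∸-monoˡ-≤ 1 k≥2) (t≥2 t≥t₀)

  X : ∀ t → t₀ ≤ t → ℝ
  X t t≥t₀ = bound p f₂ t (pos t≥t₀)

  minimum : ∃[ μ ] IsMinimum {t₀ ≤_} (λ t t≥t₀ → fromℕᴿ (f₁ + t) ⊔ᴿ X t t≥t₀) μ
  minimum = minimum-exists {a = f₁} X (Below p f₂) (below? p f₂)
    (λ {t} {M} t≥t₀ → below⇒bound≤ p f₂ {t} (pos t≥t₀) M (t≥2 t≥t₀))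
    (λ {t} {M} t≥t₀ → ¬below⇒≤bound p f₂ {t} (pos t≥t₀) M (t≥2 t≥t₀))
    (λ {s} {t} s≥t₀ t≥t₀ → bound-antitone p f₂ {s} {t} (pos s≥t₀) (pos t≥t₀) (t≥2 s≥t₀))
    -- The same t starts the search for the crossing, the decreasing term being at most f₁ + t
    -- there.
    u≥t₀ (subst (Below p f₂ u) (sym f₁+u≡f₀) below-f₀)

  μ = proj₁ minimum
  min = proj₂ minimum
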